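{- Let $G$, $\{f_v\}_{v\in V}$, $\mathcal{P}$, $T$, $\varepsilon$, $\mathbf{x}$ be an input of the Threshold Blocking problem. If $\mathbf{s}$ is the impact vector returned by the Jump Start Greedy algorithm and $\mathbf{s}^*$ is an optimal vector (i.e. of minimum $\|\mathbf{s}^*\|$) making $d_{\mathbf{x}+\mathbf{s}^*}(p)\ge T$ for all $p\in\mathcal{P}$, then $$\|\mathbf{s}\|\le O\Big(\ln\big(|\mathcal{P}|\,\varepsilon^{ -1}\big)\Big)\,\|\mathbf{s}^*\|.$$
   Context: $G=(V,E)$ is a directed graph with $|V|=n$; each node $v$ has a monotone non-decreasing function $f_v:\mathbb{R}_{\ge0}\to\mathbb{R}_{\ge0}$; $T$ is a threshold. Impact vectors are nonnegative vectors indexed by $V$, with $\|\mathbf{x}\|=\sum_v x_v$. A path is identified with its sequence of nodes; the length of $p$ under $\mathbf{x}$ is $d_{\mathbf{x}}(p)=\min(\sum_{v\in p}f_v(x_v),T)$. Given a target set $S$ of pairs of nodes, a feasible path is a path visiting no node more than once, connecting a pair in $S$, with $\sum_{v\in p}f_v(0)<T$. Threshold Blocking problem: given a finite set $\mathcal{P}$ of feasible paths with $d_{\mathbf{x}}(p)<T$ for all $p\in\mathcal P$, and a current impact vector $\mathbf{x}$, find a nonnegative vector $\mathbf{s}$ with minimum $\|\mathbf{s}\|$ such that $d_{\mathbf{x}+\mathbf{s}}(p)\ge T$ for all $p\in\mathcal{P}$. The algorithm is given an accuracy $\varepsilon\in(0,1)$ and only guarantees $d_{\mathbf{x}+\mathbf{s}}(p)\ge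 T(1-\varepsilon)$ for all $p\in\mathcal{P}$. $\langle v,y\rangle$ denotes the vector with value $y$ at entry $v$ and $0$ elsewhere. For a path set $P$, a vector $\mathbf{w}$ and a node $v$, $r_{P,\mathbf{w},v}(y)=\sum_{p\in P}\big(d_{\mathbf{w}+\langle v,y\rangle}(p)-d_{\mathbf{w}}(p)\big)$. Jump Start Greedy algorithm: Start with $\mathbf{s}=\mathbf{0}$ and a number $\beta>0$ with $\beta=O(\|\mathbf{s}^*\|/n)$. While $\mathcal{P}$ is not empty: (i) for each $v\in V$, let $\hat{x}_v$ be a maximizer of $r_{\mathcal{P},\mathbf{x}+\mathbf{s},v}(y)/y$ over $y\ge0$ (at $y=0$ the ratio is understood as its limit as $y\to0^+$); if $\hat{x}_v=0$, perform the jump start: replace $\hat{x}_v$ by a maximizer of $r_{\mathcal{P},\mathbf{x}+\mathbf{s},v}(y)/y$ over $y\ge\beta$; (ii) let $v$ be a node maximizing $r_{\mathcal{P},\mathbf{x}+\mathbf{s},v}(\hat{x}_v)/\hat{x}_v$ and set $\mathbf{s}\leftarrow\mathbf{s}+\langle v,\hat{x}_v\rangle$; (iii) remove from $\mathcal{P}$ all paths $p$ with $d_{\mathbf{x}+\mathbf{s}}(p)\ge T(1-\varepsilon)$. Return $\mathbf{s}$. All maximizers are assumed to exist. In the bound, $|\mathcal{P}|$ is the size of the input path set and the constant hidden in $O(\cdot)$ depends only on the constant in $\beta=O(\|\mathbf{s}^*\|/n)$. -}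

module Defs where

open import Algebra.Bundles using (CommutativeRing; Semiring)
import Algebra.Construct.NaturalChoice.Min as Min
import Algebra.Definitions.RawSemiring as RawSemiringDefs
open import Data.Fin.Base using (Fin)
open import Data.List.Base using (List; []; map; foldr; filter; length; head; last)
open import Data.List.Membership.Propositional using (_∈_)
open import Data.List.Relation.Unary.Linked using (Linked)
open import Data.List.Relation.Unary.Unique.Propositional using (Unique)
open import Data.Maybe.Base using (just)
open import Data.Nat.Base as ℕ using (ℕ; suc)
open import Data.Product.Base using (∃; ∃₂; _×_)
open import Data.Vec.Functional using (Vector; replicate; zipWith; updateAt)
open import Function.Base using (const)
open import Function.Definitions using (Congruent)
open import Level using (0ℓ) renaming (suc to lsuc)
open import Relation.Binary.Bundles using (DecTotalOrder)
import Relation.Binary.Construct.Add.Supremum.NonStrict as AddSupremum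
import Relation.Binary.Properties.DecTotalOrder as DecTotalOrderProperties
open import Relation.Binary.PropositionalEquality.Core using (_≡_; _≢_)
open import Relation.Binary.Structures using (IsDecTotalOrder)
open import Relation.Nullary.Construct.Add.Supremum using (_⁺; ⊤⁺; [_])
open import Relation.Nullary.Negation.Core using (¬_)
open import Relation.Nullary.Decidable using (¬?)

-- The real numbers, given axiomatically as a Dedekind-complete ordered field
-- (unique up to isomorphism), with the order decidable as in classical
-- analysis.  As usual for a totalised inverse, 0# ⁻¹ is unspecified.
record Reals : Set (lsuc 0ℓ) where
  infix  4 _≤_
  infix  8 _⁻¹
  field
    commutativeRing : CommutativeRing 0ℓ 0ℓ

  open CommutativeRing commutativeRing public
    hiding (refl; sym; trans; reflexive; isEquivalence)

  field
    _≤_             : Carrier → Carrier → Set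
    isDecTotalOrder : IsDecTotalOrder _≈_ _≤_
    _⁻¹             : Carrier → Carrier
    0≉1             : ¬ (0# ≈ 1#)
    ⁻¹-inverseʳ     : ∀ {x} → ¬ (x ≈ 0#) → x * x ⁻¹ ≈ 1#
    +-monoʳ-≤       : ∀ z {x y} → x ≤ y → z + x ≤ z + y
    *-nonNegative   : ∀ {x y} → 0# ≤ x → 0# ≤ y → 0# ≤ x * y

  IsFunction : (Carrier → Carrier) → Set
  IsFunction g = Congruent _≈_ _≈_ g

  IsUpperBound : (Carrier → Set) → Carrier → Set
  IsUpperBound A b = ∀ {x} → A x → x ≤ b

  field
    complete : (A : Carrier → Set) → ∃ A → ∃ (IsUpperBound A) →
               ∃ λ u → IsUpperBound A u × (∀ {b} → IsUpperBound A b → u ≤ b)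

  decTotalOrder : DecTotalOrder 0ℓ 0ℓ 0ℓ
  decTotalOrder = record { isDecTotalOrder = isDecTotalOrder }

  open IsDecTotalOrder isDecTotalOrder public using (_≤?_)
  open DecTotalOrderProperties decTotalOrder public using (_<_)
  open Min (DecTotalOrder.totalOrder decTotalOrder) public using (_⊓_)
  open RawSemiringDefs (Semiring.rawSemiring semiring) public using (sum; _^_) renaming (_×_ to _·_)
  open AddSupremum _≤_ public using (_≤⁺_)

  infixl 7 _÷_
  _÷_ : Carrier → Carrier → Carrier
  x ÷ y = x * y ⁻¹

  fromℕ : ℕ → Carrier
  fromℕ k = k · 1#

  ∑ : {A : Set} → List A → (A → Carrier) → Carrier
  ∑ xs g = foldr _+_ 0# (map g xs)

  Within : Carrier → Carrier → Carrier → Set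
  Within e a x = (a - e < x) × (x < a + e)

  _⟶_ : (ℕ → Carrier) → Carrier → Set
  a ⟶ l = ∀ {e} → 0# < e → ∃ λ N → ∀ k → N ℕ.≤ k → Within e l (a k)

  -- exp y = lim (1 + y/m)^m, along m = k + 1.
  IsExp : Carrier → Carrier → Set
  IsExp y z = (λ k → (1# + y ÷ fromℕ (suc k)) ^ suc k) ⟶ z

  -- IsLn z y  means  y = ln z.
  IsLn : Carrier → Carrier → Set
  IsLn z y = IsExp y z

  -- g(z) = O(ln z), uniformly on [K, ∞) for every K > 1 and so in particular as
  -- z → ∞.  A single C on all of (1, ∞) would force g(z) → 0 as z → 1⁺.
  IsO-ln : (Carrier → Carrier) → Set
  IsO-ln g = ∀ {K} → 1# < K → ∃ λ C → 0# < C ×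
    (∀ {z y} → K ≤ z → IsLn z y → 0# ≤ g z × g z ≤ C * y)

  -- The limit of h(y) as y → 0⁺, possibly +∞ (written ⊤⁺).
  LimitAt0⁺ : (Carrier → Carrier) → Carrier ⁺ → Set
  LimitAt0⁺ h [ l ] = ∀ {e} → 0# < e →
    ∃ λ δ → 0# < δ × (∀ {y} → 0# < y → y < δ → Within e l (h y))
  LimitAt0⁺ h ⊤⁺ = ∀ M →
    ∃ λ δ → 0# < δ × (∀ {y} → 0# < y → y < δ → M < h y)

  data RatioValue (r : Carrier → Carrier) (y : Carrier) : Carrier ⁺ → Set where
    at-positive : 0# < y → RatioValue r y [ r y ÷ y ]
    at-zero     : ∀ {l} → y ≈ 0# → LimitAt0⁺ (λ z → r z ÷ z) l → RatioValue r y l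

  -- y maximizes r(y)/y over the set D.
  MaximizesRatio : (Carrier → Carrier) → (Carrier → Set) → Carrier → Set
  MaximizesRatio r D y = D y × ∃ λ m → RatioValue r y m ×
    (∀ {z m′} → D z → RatioValue r z m′ → m′ ≤⁺ m)

module ThresholdBlocking (R : Reals) where
  open Reals R

  Path : ℕ → Set
  Path n = List (Fin n)

  ‖_‖ : ∀ {n} → Vector Carrier n → Carrier
  ‖ x ‖ = sum x

  NonNegative : ∀ {n} → Vector Carrier n → Set
  NonNegative x = ∀ v → 0# ≤ x v

  infixl 6 _⊕_
  _⊕_ : ∀ {n} → Vector Carrier n → Vector Carrier n → Vector Carrier n
  _⊕_ = zipWith _+_

  𝟎 : ∀ {n} → Vector Carrier n
  𝟎 = replicate _ 0#

  ⟨_,_⟩ : ∀ {n} → Fin n → Carrier → Vector Carrier n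
  ⟨ v , y ⟩ = updateAt 𝟎 v (const y)

  pathLength : ∀ {n} → (Fin n → Carrier → Carrier) → Carrier →
               Vector Carrier n → Path n → Carrier
  pathLength f T x p = ∑ p (λ v → f v (x v)) ⊓ T

  record IsFeasible {n} (E S : Fin n → Fin n → Set) (f : Fin n → Carrier → Carrier)
                    (T : Carrier) (p : Path n) : Set where
    field
      edges          : Linked E p
      simple         : Unique p
      connects       : ∃₂ λ a b → S a b × head p ≡ just a × last p ≡ just b
      belowThreshold : ∑ p (λ v → f v 0#) < T

  -- An input of the problem.  The functions f v : ℝ≥0 → ℝ≥0 are represented by
  -- functions on Carrier whose values at negative arguments are irrelevant.
  record Instance : Set₁ where
    field
      n            : ℕ
      E            : Fin n → Fin n → Set
      S            : Fin n → Fin n → Set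
      f            : Fin n → Carrier → Carrier
      f-nonneg     : ∀ v {y} → 0# ≤ y → 0# ≤ f v y
      f-mono       : ∀ v {y z} → 0# ≤ y → y ≤ z → f v y ≤ f v z
      T            : Carrier
      ε            : Carrier
      0<ε          : 0# < ε
      ε<1          : ε < 1#
      x            : Vector Carrier n
      x-nonneg     : NonNegative x
      𝒫            : List (Path n)
      𝒫-distinct   : Unique 𝒫
      𝒫-feasible   : ∀ {p} → p ∈ 𝒫 → IsFeasible E S f T p
      𝒫-below      : ∀ {p} → p ∈ 𝒫 → pathLength f T x p < T

    d : Vector Carrier n → Path n → Carrier
    d = pathLength f T

    Blocks : Vector Carrier n → Set
    Blocks s = NonNegative s × (∀ {p} → p ∈ 𝒫 → T ≤ d (x ⊕ s) p)

    IsOptimal : Vector Carrier n → Set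
    IsOptimal s = Blocks s × (∀ {s′} → Blocks s′ → ‖ s ‖ ≤ ‖ s′ ‖)

    r : List (Path n) → Vector Carrier n → Fin n → Carrier → Carrier
    r P w v y = ∑ P (λ p → d (w ⊕ ⟨ v , y ⟩) p - d w p)

    -- The values x̂ that may be used for a node with gain function g.
    data Candidate (β : Carrier) (g : Carrier → Carrier) (x̂ : Carrier) : Set where
      regular   : MaximizesRatio g (0# ≤_) x̂ → ¬ (x̂ ≈ 0#) → Candidate β g x̂
      jumpStart : MaximizesRatio g (0# ≤_) 0# → MaximizesRatio g (β ≤_) x̂ →
                  Candidate β g x̂

    removeBlocked : Vector Carrier n → List (Path n) → List (Path n)
    removeBlocked w = filter (λ p → ¬? (T * (1# - ε) ≤? d w p))

    -- Run β P s s′: from remaining paths P and current vector s, some execution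
    -- of the loop (with any resolution of ties) terminates and returns s′.
    data Run (β : Carrier) : List (Path n) → Vector Carrier n → Vector Carrier n → Set where
      done : ∀ {s} → Run β [] s s
      step : ∀ {P s s′} → P ≢ [] →
             (x̂ : Vector Carrier n) →
             (∀ v → Candidate β (r P (x ⊕ s) v) (x̂ v)) →
             (v : Fin n) →
             (∀ u → r P (x ⊕ s) u (x̂ u) ÷ x̂ u ≤ r P (x ⊕ s) v (x̂ v) ÷ x̂ v) →
             Run β (removeBlocked (x ⊕ (s ⊕ ⟨ v , x̂ v ⟩)) P) (s ⊕ ⟨ v , x̂ v ⟩) s′ →
             Run β P s s′

    JumpStartGreedyReturns : Carrier → Vector Carrier n → Set
    JumpStartGreedyReturns β s = Run β 𝒫 𝟎 s

    -- |𝒫| ε⁻¹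
    |𝒫|ε⁻¹ : Carrier
    |𝒫|ε⁻¹ = fromℕ (length 𝒫) * ε ⁻¹

module Submission where

-- Let M = ‖s*‖ + nβ ≤ (1 + c) ‖s*‖ and let the potential φ be the sum of T − d(p) over the remaining paths p.
-- Truncation at T makes d submodular in the increments, so raising single nodes v by s*_v gains at least φ
-- in total; a candidate value bounds the gain of s*_v by its ratio times s*_v + β.  Hence the best ratio is at
-- least φ/M, that is, an increase of s by y lowers φ by at least y φ/M.  After the first step φ is at
-- most |𝒫|T, and at least εT while a path remains, so ‖s‖ is M times a quantity of order log₂ (|𝒫|/ε).
-- The factor g uses log₂ z = sup {k : 2ᵏ ≤ z}, which is compared with ln through 1/(1 − y) ≥ eʸ.

open import Defs
open import Algebra.Bundles using (CommutativeRing)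
import Algebra.Construct.NaturalChoice.Min as Min
import Algebra.Properties.AbelianGroup as AbelianGroupProperties
import Algebra.Properties.CommutativeSemiring.Exp as ExpProperties
import Algebra.Properties.Monoid.Mult.TCOptimised as OptimisedMonoidMult
import Algebra.Properties.Ring as RingProperties
import Algebra.Properties.Semiring.Mult as MultProperties
import Algebra.Properties.Semiring.Mult.TCOptimised as OptimisedSemiringMult
import Algebra.Properties.Semiring.Sum as SumProperties
import Algebra.Solver.Ring as RingSolver
open import Algebra.Solver.Ring.AlmostCommutativeRing using (fromCommutativeRing; _-Raw-AlmostCommutative⟶_)
open import Data.Fin.Base using (Fin; zero; suc)
open import Data.Integer.Base as ℤ using (ℤ; +_; -[1+_]; 0ℤ; 1ℤ)
import Data.Integer.Properties as ℤ
open import Data.List.Base using (List; []; _∷_; length; filter)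
open import Data.List.Membership.Propositional using (_∈_)
open import Data.List.Membership.Propositional.Properties using (∈-filter⁻)
open import Data.List.Properties using (length-filter)
open import Data.List.Relation.Unary.Any using (here; there)
open import Data.Maybe.Base using (map)
open import Data.Nat.Base as ℕ using (ℕ; zero; suc)
import Data.Nat.Properties as ℕ
open import Data.Product.Base using (∃; _×_; _,_; proj₁; proj₂)
import Data.Sign.Base as Sign
open import Data.Sum.Base using (_⊎_; inj₁; inj₂)
open import Data.Vec.Functional using (Vector)
open import Data.Vec.Functional.Properties using (updateAt-updates)
open import Function.Base using (_∘_)
open import Relation.Binary.Bundles using (DecTotalOrder)
open import Relation.Binary.Consequences using (dec⇒weaklyDec)
open import Relation.Binary.Construct.Add.Supremum.NonStrict using ([≤]-injective)
open import Relation.Binary.Definitions using (WeaklyDecidable)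
import Relation.Binary.Properties.DecTotalOrder as DecTotalOrderProperties
open import Relation.Binary.PropositionalEquality.Core as ≡ using (_≡_; _≢_)
import Relation.Binary.Reasoning.Setoid as SetoidReasoning
open import Relation.Nullary.Decidable.Core using (yes; no; ¬?)
open import Relation.Nullary.Negation.Core using (¬_; contradiction)
open import Relation.Unary using (Decidable)

-- A decay of φ by the factor 1 - y/M per step calls for logarithms of potentials, but `Reals` has
-- ln only as a relation. So the run is charged along dyadic levels 2ᵏ ε T: while φ is at least the
-- level q, an increase y of the norm satisfies q y ≤ M (drop of φ), so each halving of φ accounts
-- for one further M. The factor (1 + c)(3 + log₂ z) arises as follows. M ≤ (1 + c) ‖s*‖ because n β
-- ≤ c ‖s*‖. One unit of the 3 pays for the first step; two pay for starting the descent at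
-- potential 2 · 2ᵏ ε T, that is, at twice the level k. The remaining k is at most log₂ z. The
-- additive 3 is O(ln z) only away from z = 1: on [K, ∞) it is charged to ln z ≥ 1 - 1/K. The number
-- k with 2ᵏ⁺¹ ≥ |𝒫|/ε is obtained only under a double negation, which the decidable order removes
-- from the final inequality.

-- A ring solver with integer constants.

module IntegerCoefficientSolver {c ℓ} (R : CommutativeRing c ℓ) where
  open CommutativeRing R
  open OptimisedMonoidMult +-monoid using (1+×; ×-homo-+) renaming (_×_ to _×′_)
  open OptimisedSemiringMult semiring using (×1-homo-*)
  open RingProperties ring using (-0#≈0#; -‿distribˡ-*; -‿distribʳ-*; -‿involutive)
  open AbelianGroupProperties +-abelianGroup using () renaming (⁻¹-∙-comm to -‿+-comm)
  open SetoidReasoning setoid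

  private
    -- With the optimised multiples, `con 0ℤ` and `con 1ℤ` evaluate to `0#` and `1#` themselves
    -- rather than to sums such as `1# + 0#`, so goals written with these constants close by
    -- reflexivity.
    ⟦_⟧ : ℤ → Carrier
    ⟦ + n ⟧ = n ×′ 1#
    ⟦ -[1+ n ] ⟧ = - (suc n ×′ 1#)

    cancel-suc : ∀ x y → (1# + x) - (1# + y) ≈ x - y
    cancel-suc x y = begin
      (1# + x) - (1# + y)        ≈⟨ +-cong (+-comm 1# x) (sym (-‿+-comm 1# y)) ⟩
      (x + 1#) + (- 1# + - y)    ≈⟨ +-assoc x 1# _ ⟩
      x + (1# + (- 1# + - y))    ≈⟨ +-congˡ (sym (+-assoc 1# (- 1#) (- y))) ⟩
      x + ((1# - 1#) - y)        ≈⟨ +-congˡ (+-congʳ (-‿inverseʳ 1#)) ⟩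
      x + (0# - y)               ≈⟨ +-congˡ (+-identityˡ (- y)) ⟩
      x - y                      ∎

    ⊖-homo : ∀ m n → ⟦ m ℤ.⊖ n ⟧ ≈ m ×′ 1# - n ×′ 1#
    ⊖-homo m zero = sym (trans (+-congˡ -0#≈0#) (+-identityʳ _))
    ⊖-homo zero (suc n) = sym (+-identityˡ _)
    ⊖-homo (suc m) (suc n) = begin
      ⟦ suc m ℤ.⊖ suc n ⟧                  ≡⟨ ≡.cong ⟦_⟧ (ℤ.[1+m]⊖[1+n]≡m⊖n m n) ⟩
      ⟦ m ℤ.⊖ n ⟧                          ≈⟨ ⊖-homo m n ⟩
      m ×′ 1# - n ×′ 1#                    ≈⟨ cancel-suc _ _ ⟨
      (1# + m ×′ 1#) - (1# + n ×′ 1#)      ≈⟨ +-cong (1+× m 1#) (-‿cong (1+× n 1#)) ⟨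
      suc m ×′ 1# - suc n ×′ 1#            ∎

    -‿homo : ∀ i → ⟦ ℤ.- i ⟧ ≈ - ⟦ i ⟧
    -‿homo (+ zero)  = sym -0#≈0#
    -‿homo (+ suc n) = refl
    -‿homo -[1+ n ]  = sym (-‿involutive _)

    +-homo : ∀ i j → ⟦ i ℤ.+ j ⟧ ≈ ⟦ i ⟧ + ⟦ j ⟧
    +-homo (+ m)    (+ n)    = ×-homo-+ 1# m n
    +-homo (+ m)    -[1+ n ] = ⊖-homo m (suc n)
    +-homo -[1+ m ] (+ n)    = trans (⊖-homo n (suc m)) (+-comm _ _)
    +-homo -[1+ m ] -[1+ n ] = begin
      - (suc (suc (m ℕ.+ n)) ×′ 1#)        ≡⟨ ≡.cong (λ k → - (suc k ×′ 1#)) (ℕ.+-suc m n) ⟨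
      - ((suc m ℕ.+ suc n) ×′ 1#)          ≈⟨ -‿cong (×-homo-+ 1# (suc m) (suc n)) ⟩
      - (suc m ×′ 1# + suc n ×′ 1#)        ≈⟨ -‿+-comm _ _ ⟨
      - (suc m ×′ 1#) + - (suc n ×′ 1#)    ∎

    -◃-homo : ∀ n → ⟦ Sign.- ℤ.◃ n ⟧ ≈ - (n ×′ 1#)
    -◃-homo zero    = sym -0#≈0#
    -◃-homo (suc n) = refl

    +◃-homo : ∀ n → ⟦ Sign.+ ℤ.◃ n ⟧ ≈ n ×′ 1#
    +◃-homo n = reflexive (≡.cong ⟦_⟧ (ℤ.+◃n≡+n n))

    *-homo : ∀ i j → ⟦ i ℤ.* j ⟧ ≈ ⟦ i ⟧ * ⟦ j ⟧
    *-homo (+ m)    (+ n)    = trans (+◃-homo (m ℕ.* n)) (×1-homo-* m n)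
    *-homo (+ m)    -[1+ n ] = begin
      ⟦ Sign.- ℤ.◃ m ℕ.* suc n ⟧       ≈⟨ -◃-homo (m ℕ.* suc n) ⟩
      - ((m ℕ.* suc n) ×′ 1#)          ≈⟨ -‿cong (×1-homo-* m (suc n)) ⟩
      - (m ×′ 1# * suc n ×′ 1#)        ≈⟨ -‿distribʳ-* _ _ ⟩
      m ×′ 1# * - (suc n ×′ 1#)        ∎
    *-homo -[1+ m ] (+ n)    = begin
      ⟦ Sign.- ℤ.◃ suc m ℕ.* n ⟧       ≈⟨ -◃-homo (suc m ℕ.* n) ⟩
      - ((suc m ℕ.* n) ×′ 1#)          ≈⟨ -‿cong (×1-homo-* (suc m) n) ⟩
      - (suc m ×′ 1# * n ×′ 1#)        ≈⟨ -‿distribˡ-* _ _ ⟩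
      - (suc m ×′ 1#) * n ×′ 1#        ∎
    *-homo -[1+ m ] -[1+ n ] = begin
      (suc m ℕ.* suc n) ×′ 1#                ≈⟨ ×1-homo-* (suc m) (suc n) ⟩
      suc m ×′ 1# * suc n ×′ 1#              ≈⟨ -‿involutive _ ⟨
      - - (suc m ×′ 1# * suc n ×′ 1#)        ≈⟨ -‿cong (-‿distribʳ-* _ _) ⟩
      - (suc m ×′ 1# * - (suc n ×′ 1#))      ≈⟨ -‿distribˡ-* _ _ ⟩
      - (suc m ×′ 1#) * - (suc n ×′ 1#)      ∎

    homomorphism : ℤ.+-*-rawRing -Raw-AlmostCommutative⟶ fromCommutativeRing R
    homomorphism = record
      { ⟦_⟧    = ⟦_⟧
      ; +-homo = +-homo
      ; *-homo = *-homo
      ; -‿homo = -‿homo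
      ; 0-homo = refl
      ; 1-homo = refl
      }

    coefficient≟ : WeaklyDecidable (λ i j → ⟦ i ⟧ ≈ ⟦ j ⟧)
    coefficient≟ i j = map (λ i≡j → reflexive (≡.cong ⟦_⟧ i≡j)) (dec⇒weaklyDec ℤ._≟_ i j)

  open RingSolver ℤ.+-*-rawRing (fromCommutativeRing R) homomorphism coefficient≟ public
    using (solve; _:=_; _:+_; _:*_; _:-_; :-_; con)

-- Arithmetic of ordered fields, the Archimedean property and Bernoulli's inequality.

module OrderedFieldProperties (R : Reals) where
  open Reals R public hiding (zero)
  open CommutativeRing commutativeRing public using ()
    renaming (refl to ≈-refl; reflexive to ≈-reflexive; sym to ≈-sym; trans to ≈-trans)
  open DecTotalOrder decTotalOrder public using (≤-respˡ-≈; ≤-respʳ-≈)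
    renaming (refl to ≤-refl; reflexive to ≤-reflexive; trans to ≤-trans; antisym to ≤-antisym; total to ≤-total)
  open DecTotalOrderProperties decTotalOrder public using (≰⇒>; <⇒≱)
  open Min (DecTotalOrder.totalOrder decTotalOrder) public using (x⊓y≤x; x⊓y≤y; ⊓-glb; ⊓-mono-≤; ⊓-cong; ⊓-sel)
  open IntegerCoefficientSolver commutativeRing public
  open ExpProperties commutativeSemiring public using (^-congˡ; ^-assocʳ; ^-distrib-*)
  open MultProperties semiring public using (×1-homo-*)
  open SetoidReasoning setoid

  ≮⇒≥ : ∀ {x y} → ¬ (x < y) → y ≤ x
  ≮⇒≥ {x} {y} x≮y with y ≤? x
  ... | yes y≤x = y≤x
  ... | no  y≰x = contradiction (≰⇒> y≰x) x≮y

  -- This is what allows an inequality to be derived from a natural number that exists only up to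
  -- double negation.
  ≤-stable : ∀ {x y} → ¬ ¬ (x ≤ y) → x ≤ y
  ≤-stable {x} {y} ¬¬x≤y with x ≤? y
  ... | yes x≤y = x≤y
  ... | no  x≰y = contradiction x≰y ¬¬x≤y

  -- Splits an inequality into the nonnegativity of a certificate `p`, usually a combination of
  -- hypotheses, and a ring identity left to `solve`.
  ≤-via-difference : ∀ {p x y} → 0# ≤ p → p ≈ y - x → x ≤ y
  ≤-via-difference {p} {x} {y} 0≤p p≈y-x =
    ≤-respˡ-≈ (+-identityʳ x) (≤-respʳ-≈ x+p≈y (+-monoʳ-≤ x 0≤p))
    where
    x+p≈y : x + p ≈ y
    x+p≈y = ≈-trans (+-congˡ p≈y-x) (solve 2 (λ x y → x :+ (y :- x) := y) ≈-refl x y)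

  0≤difference : ∀ {x y} → x ≤ y → 0# ≤ y - x
  0≤difference {x} {y} x≤y =
    ≤-respˡ-≈ (-‿inverseˡ x) (≤-respʳ-≈ (+-comm (- x) y) (+-monoʳ-≤ (- x) x≤y))

  -‿anti-≤ : ∀ {x y} → x ≤ y → - y ≤ - x
  -‿anti-≤ {x} {y} x≤y = ≤-via-difference (0≤difference x≤y)
    (solve 2 (λ x y → y :- x := :- x :- (:- y)) ≈-refl x y)

  +-nonNegative : ∀ {x y} → 0# ≤ x → 0# ≤ y → 0# ≤ x + y
  +-nonNegative {x} 0≤x 0≤y = ≤-trans 0≤x (≤-respˡ-≈ (+-identityʳ x) (+-monoʳ-≤ x 0≤y))

  +-mono-≤ : ∀ {u v x y} → u ≤ v → x ≤ y → u + x ≤ v + y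
  +-mono-≤ {u} {v} {x} {y} u≤v x≤y = ≤-trans (+-monoʳ-≤ u x≤y)
    (≤-respˡ-≈ (+-comm y u) (≤-respʳ-≈ (+-comm y v) (+-monoʳ-≤ y u≤v)))

  square-nonNegative : ∀ x → 0# ≤ x * x
  square-nonNegative x with ≤-total 0# x
  ... | inj₁ 0≤x = *-nonNegative 0≤x 0≤x
  ... | inj₂ x≤0 = ≤-respʳ-≈ (solve 1 (λ x → (con 0ℤ :- x) :* (con 0ℤ :- x) := x :* x) ≈-refl x)
                     (*-nonNegative (0≤difference x≤0) (0≤difference x≤0))

  x≤x+y : ∀ x {y} → 0# ≤ y → x ≤ x + y
  x≤x+y x 0≤y = ≤-respˡ-≈ (+-identityʳ x) (+-monoʳ-≤ x 0≤y)

  x≤y+x : ∀ x {y} → 0# ≤ y → x ≤ y + x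
  x≤y+x x {y} 0≤y = ≤-respʳ-≈ (+-comm x y) (x≤x+y x 0≤y)

  *-monoˡ-≤ : ∀ {z x y} → 0# ≤ z → x ≤ y → z * x ≤ z * y
  *-monoˡ-≤ {z} {x} {y} 0≤z x≤y = ≤-via-difference (*-nonNegative 0≤z (0≤difference x≤y))
    (solve 3 (λ x y z → z :* (y :- x) := z :* y :- z :* x) ≈-refl x y z)

  *-mono-≤ : ∀ {u v x y} → 0# ≤ u → 0# ≤ y → u ≤ v → x ≤ y → u * x ≤ v * y
  *-mono-≤ {u} {v} {x} {y} 0≤u 0≤y u≤v x≤y = ≤-trans (*-monoˡ-≤ 0≤u x≤y)
    (≤-respˡ-≈ (*-comm y u) (≤-respʳ-≈ (*-comm y v) (*-monoˡ-≤ 0≤y u≤v)))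

  0≤1 : 0# ≤ 1#
  0≤1 = ≤-respʳ-≈ (*-identityˡ 1#) (square-nonNegative 1#)

  0<1 : 0# < 1#
  0<1 = 0≤1 , 0≉1

  1≰0 : ¬ (1# ≤ 0#)
  1≰0 = <⇒≱ 0<1

  0<⇒≉0 : ∀ {x} → 0# < x → ¬ (x ≈ 0#)
  0<⇒≉0 (_ , 0≉x) x≈0 = 0≉x (≈-sym x≈0)

  <-≤-trans : ∀ {x y z} → x < y → y ≤ z → x < z
  <-≤-trans (x≤y , x≉y) y≤z = ≤-trans x≤y y≤z , λ x≈z → x≉y (≤-antisym x≤y (≤-respʳ-≈ (≈-sym x≈z) y≤z))

  ≤-<-trans : ∀ {x y z} → x ≤ y → y < z → x < z
  ≤-<-trans x≤y (y≤z , y≉z) = ≤-trans x≤y y≤z , λ x≈z → y≉z (≤-antisym y≤z (≤-respˡ-≈ x≈z x≤y))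

  0<difference : ∀ {x y} → x < y → 0# < y - x
  0<difference {x} {y} (x≤y , x≉y) = 0≤difference x≤y , λ 0≈y-x → x≉y (begin
    x            ≈⟨ +-identityʳ x ⟨
    x + 0#       ≈⟨ +-congˡ 0≈y-x ⟩
    x + (y - x)  ≈⟨ solve 2 (λ x y → x :+ (y :- x) := y) ≈-refl x y ⟩
    y            ∎)

  ⁻¹-inverseˡ : ∀ {x} → 0# < x → x ⁻¹ * x ≈ 1#
  ⁻¹-inverseˡ 0<x = ≈-trans (*-comm _ _) (⁻¹-inverseʳ (0<⇒≉0 0<x))

  ⁻¹-positive : ∀ {x} → 0# < x → 0# < x ⁻¹
  ⁻¹-positive {x} 0<x@(0≤x , _) with x ⁻¹ ≤? 0#
  ... | no  x⁻¹≰0 = ≰⇒> x⁻¹≰0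
  ... | yes x⁻¹≤0 = contradiction (≤-respʳ-≈ (zeroʳ x) (≤-respˡ-≈ (⁻¹-inverseʳ (0<⇒≉0 0<x)) (*-monoˡ-≤ 0≤x x⁻¹≤0))) 1≰0

  ⁻¹-cancelˡ : ∀ {x} y → 0# < x → x ⁻¹ * (x * y) ≈ y
  ⁻¹-cancelˡ {x} y 0<x = begin
    x ⁻¹ * (x * y)  ≈⟨ *-assoc (x ⁻¹) x y ⟨
    x ⁻¹ * x * y    ≈⟨ *-congʳ (⁻¹-inverseˡ 0<x) ⟩
    1# * y          ≈⟨ *-identityˡ y ⟩
    y               ∎

  ÷-cancel : ∀ {x} y → 0# < x → x * (y ÷ x) ≈ y
  ÷-cancel {x} y 0<x = ≈-trans (solve 3 (λ x y z → x :* (y :* z) := z :* (x :* y)) ≈-refl x y (x ⁻¹)) (⁻¹-cancelˡ y 0<x)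

  *-cancelˡ-≤ : ∀ {z x y} → 0# < z → z * x ≤ z * y → x ≤ y
  *-cancelˡ-≤ {z} {x} {y} 0<z zx≤zy =
    ≤-respˡ-≈ (⁻¹-cancelˡ x 0<z) (≤-respʳ-≈ (⁻¹-cancelˡ y 0<z) (*-monoˡ-≤ (proj₁ (⁻¹-positive 0<z)) zx≤zy))

  *-cancelˡ-≈ : ∀ {z x y} → 0# < z → z * x ≈ z * y → x ≈ y
  *-cancelˡ-≈ 0<z zx≈zy = ≤-antisym (*-cancelˡ-≤ 0<z (≤-reflexive zx≈zy)) (*-cancelˡ-≤ 0<z (≤-reflexive (≈-sym zx≈zy)))

  ÷-nonNegative : ∀ {x y} → 0# ≤ x → 0# < y → 0# ≤ x ÷ y
  ÷-nonNegative 0≤x 0<y = *-nonNegative 0≤x (proj₁ (⁻¹-positive 0<y))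

  *-positive : ∀ {x y} → 0# < x → 0# < y → 0# < x * y
  *-positive {x} {y} 0<x@(0≤x , _) (0≤y , 0≉y) = *-nonNegative 0≤x 0≤y ,
    λ 0≈xy → 0≉y (≈-trans (≈-sym (zeroʳ (x ⁻¹))) (≈-trans (*-congˡ 0≈xy) (⁻¹-cancelˡ y 0<x)))

  *-monoˡ-< : ∀ {z x y} → 0# < z → x < y → z * x < z * y
  *-monoˡ-< {z} 0<z x<y = ≰⇒> λ zy≤zx → <⇒≱ x<y (*-cancelˡ-≤ 0<z zy≤zx)

  fromℕ-nonNegative : ∀ k → 0# ≤ fromℕ k
  fromℕ-nonNegative zero    = ≤-refl
  fromℕ-nonNegative (suc k) = +-nonNegative 0≤1 (fromℕ-nonNegative k)

  1≤fromℕ-suc : ∀ k → 1# ≤ fromℕ (suc k)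
  1≤fromℕ-suc k = x≤x+y 1# (fromℕ-nonNegative k)

  fromℕ-suc-positive : ∀ k → 0# < fromℕ (suc k)
  fromℕ-suc-positive k = <-≤-trans 0<1 (1≤fromℕ-suc k)

  fromℕ-mono-≤ : ∀ {j k} → j ℕ.≤ k → fromℕ j ≤ fromℕ k
  fromℕ-mono-≤ {k = k} ℕ.z≤n = fromℕ-nonNegative k
  fromℕ-mono-≤ (ℕ.s≤s j≤k)   = +-monoʳ-≤ 1# (fromℕ-mono-≤ j≤k)

  -- If `u` were the least upper bound of the naturals, then k + 1 ≤ u for every k would make u - 1
  -- an upper bound as well.
  archimedean : ∀ b → ¬ (∀ k → fromℕ k ≤ b)
  archimedean b ℕ≤b with complete (λ q → ∃ λ k → q ≈ fromℕ k) (0# , 0 , ≈-refl)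
                                  (b , λ (k , q≈k) → ≤-respˡ-≈ (≈-sym q≈k) (ℕ≤b k))
  ... | u , u-bound , u-least = 1≰0 (≤-via-difference (0≤difference u≤u-1)
          (solve 1 (λ u → u :- con 1ℤ :- u := con 0ℤ :- con 1ℤ) ≈-refl u))
    where
    u≤u-1 : u ≤ u - 1#
    u≤u-1 = u-least λ (k , q≈k) → ≤-respˡ-≈ (≈-sym q≈k)
      (≤-via-difference (0≤difference (u-bound (suc k , ≈-refl)))
        (solve 2 (λ u k → u :- (con 1ℤ :+ k) := u :- con 1ℤ :- k) ≈-refl u (fromℕ k)))

  ^-nonNegative : ∀ {x} k → 0# ≤ x → 0# ≤ x ^ k
  ^-nonNegative zero    0≤x = 0≤1
  ^-nonNegative (suc k) 0≤x = *-nonNegative 0≤x (^-nonNegative k 0≤x)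

  ^-positive : ∀ {x} k → 0# < x → 0# < x ^ k
  ^-positive zero    0<x = 0<1
  ^-positive (suc k) 0<x = *-positive 0<x (^-positive k 0<x)

  ^-mono-≤ : ∀ {x y} k → 0# ≤ x → x ≤ y → x ^ k ≤ y ^ k
  ^-mono-≤ zero    0≤x x≤y = ≤-refl
  ^-mono-≤ (suc k) 0≤x x≤y =
    *-mono-≤ 0≤x (^-nonNegative k (≤-trans 0≤x x≤y)) x≤y (^-mono-≤ k 0≤x x≤y)

  ^-monoˡ-< : ∀ {x y} k → 0# ≤ x → x < y → x ^ suc k < y ^ suc k
  ^-monoˡ-< {x} {y} k 0≤x x<y@(x≤y , _) =
    ≤-<-trans (*-monoˡ-≤ 0≤x (^-mono-≤ k 0≤x x≤y))
      (≤-<-trans (≤-reflexive (*-comm x _))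
        (<-≤-trans (*-monoˡ-< (^-positive k (≤-<-trans 0≤x x<y)) x<y) (≤-reflexive (*-comm _ y))))

  ^-≤1 : ∀ {x} k → 0# ≤ x → x ≤ 1# → x ^ k ≤ 1#
  ^-≤1 zero    0≤x x≤1 = ≤-refl
  ^-≤1 (suc k) 0≤x x≤1 = ≤-respʳ-≈ (*-identityˡ 1#) (*-mono-≤ 0≤x 0≤1 x≤1 (^-≤1 k 0≤x x≤1))

  -- The induction multiplies by the nonnegative `1# - a`, and the two sides then differ by exactly
  -- k a².
  bernoulli : ∀ {a} k → a ≤ 1# → 1# - fromℕ k * a ≤ (1# - a) ^ k
  bernoulli {a} zero    a≤1 = ≤-reflexive (solve 1 (λ a → con 1ℤ :- con 0ℤ :* a := con 1ℤ) ≈-refl a)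
  bernoulli {a} (suc k) a≤1 = ≤-trans
    (≤-via-difference (*-nonNegative (fromℕ-nonNegative k) (square-nonNegative a))
      (solve 2 (λ a k → k :* (a :* a) := (con 1ℤ :- a) :* (con 1ℤ :- k :* a) :- (con 1ℤ :- (con 1ℤ :+ k) :* a))
        ≈-refl a (fromℕ k)))
    (*-monoˡ-≤ (0≤difference a≤1) (bernoulli k a≤1))

  -- Bernoulli replaces 1 - k a by (1 - a)ᵏ, and the product is then (1 - a²)ᵏ. With a = y/k this is
  -- the finite form of eʸ (1 - y) ≤ 1.
  [1+a]^k*[1-ka]≤1 : ∀ {a} k → - 1# ≤ a → a ≤ 1# → (1# + a) ^ k * (1# - fromℕ k * a) ≤ 1#
  [1+a]^k*[1-ka]≤1 {a} k -1≤a a≤1 = ≤-trans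
    (*-monoˡ-≤ (^-nonNegative k 0≤1+a) (bernoulli k a≤1))
    (≤-respˡ-≈ (^-distrib-* _ _ k) (^-≤1 k (*-nonNegative 0≤1+a (0≤difference a≤1)) 1-a²≤1))
    where
    0≤1+a : 0# ≤ 1# + a
    0≤1+a = ≤-respʳ-≈ (solve 1 (λ a → a :- (:- con 1ℤ) := con 1ℤ :+ a) ≈-refl a) (0≤difference -1≤a)

    1-a²≤1 : (1# + a) * (1# - a) ≤ 1#
    1-a²≤1 = ≤-via-difference (square-nonNegative a)
      (solve 1 (λ a → a :* a := con 1ℤ :- (con 1ℤ :+ a) :* (con 1ℤ :- a)) ≈-refl a)

-- Comparison of the relational logarithm with a binary one.

module LogarithmBounds (R : Reals) where
  open OrderedFieldProperties R
  open SetoidReasoning setoid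

  2# : Carrier
  2# = 1# + 1#

  0≤2 : 0# ≤ 2#
  0≤2 = +-nonNegative 0≤1 0≤1

  0<2 : 0# < 2#
  0<2 = <-≤-trans 0<1 (x≤x+y 1# 0≤1)

  expTerm : Carrier → ℕ → Carrier
  expTerm y i = (1# + y ÷ fromℕ (suc i)) ^ suc i

  -- If b < z, closeness to z within z - b puts all late terms above b. As the hypothesis only
  -- denies this, a subsequence of indices, or an index known only up to double negation, is enough
  -- to apply the lemma.
  exp-≤ : ∀ {y z b} → IsExp y z → (∀ N → ¬ (∀ i → N ℕ.≤ i → b < expTerm y i)) → z ≤ b
  exp-≤ {y} {z} {b} y↦z frequently≤b = ≮⇒≥ λ b<z →
    let N , near = y↦z (0<difference b<z) in
    frequently≤b N λ i N≤i →
      ≤-<-trans (≤-reflexive (solve 2 (λ b z → b := z :- (z :- b)) ≈-refl b z)) (proj₁ (near i N≤i))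

  -1≤y÷k : ∀ {y k} → 0# < k → - k ≤ y → - 1# ≤ y ÷ k
  -1≤y÷k {y} {k} 0<k -k≤y = *-cancelˡ-≤ 0<k
    (≤-respˡ-≈ (solve 1 (λ k → :- k := k :* (:- con 1ℤ)) ≈-refl k)
      (≤-respʳ-≈ (≈-sym (÷-cancel y 0<k)) -k≤y))

  y÷k≤1 : ∀ {y k} → 0# < k → y ≤ k → y ÷ k ≤ 1#
  y÷k≤1 {y} {k} 0<k y≤k = *-cancelˡ-≤ 0<k
    (≤-respˡ-≈ (≈-sym (÷-cancel y 0<k)) (≤-respʳ-≈ (≈-sym (*-identityʳ k)) y≤k))

  [1+y÷k]^k≤[1-y]⁻¹ : ∀ {y} i → - fromℕ (suc i) ≤ y → y < 1# → expTerm y i ≤ (1# - y) ⁻¹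
  [1+y÷k]^k≤[1-y]⁻¹ {y} i -k≤y y<1@(y≤1 , _) = *-cancelˡ-≤ 0<1-y (≤-trans
    (≤-reflexive (begin
      (1# - y) * expTerm y i            ≈⟨ *-comm _ _ ⟩
      expTerm y i * (1# - y)            ≈⟨ *-congˡ (+-congˡ (-‿cong (÷-cancel y 0<k))) ⟨
      expTerm y i * (1# - k * (y ÷ k))  ∎))
    (≤-respʳ-≈ (≈-sym (⁻¹-inverseʳ (0<⇒≉0 0<1-y)))
      ([1+a]^k*[1-ka]≤1 (suc i) (-1≤y÷k 0<k -k≤y) (y÷k≤1 0<k (≤-trans y≤1 (1≤fromℕ-suc i))))))
    where
    k : Carrier
    k = fromℕ (suc i)

    0<k : 0# < k
    0<k = fromℕ-suc-positive i

    0<1-y : 0# < 1# - y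
    0<1-y = 0<difference y<1

  exp-≤-[1-y]⁻¹ : ∀ {y z} → IsExp y z → y < 1# → z ≤ (1# - y) ⁻¹
  -- The bound on a term needs an index large enough that 1 + y/k is nonnegative; for negative `y`
  -- this is the Archimedean property at `- y`.
  exp-≤-[1-y]⁻¹ {y} y↦z y<1 = exp-≤ y↦z λ N above → archimedean (- y) λ n → ≮⇒≥ λ -y<n →
    <⇒≱ (above (N ℕ.+ n) (ℕ.m≤m+n N n))
      ([1+y÷k]^k≤[1-y]⁻¹ (N ℕ.+ n)
        (≤-respʳ-≈ (solve 1 (λ y → :- (:- y) := y) ≈-refl y)
          (-‿anti-≤ (≤-trans (proj₁ -y<n) (fromℕ-mono-≤ (ℕ.≤-trans (ℕ.m≤n+m n N) (ℕ.n≤1+n _))))))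
        y<1)

  -- Otherwise 1/K < 1 - y, which contradicts K ≤ z ≤ 1/(1 - y). The bound keeps ln away from 0 on
  -- [K, ∞).
  1-K⁻¹≤ln : ∀ {K z y} → 1# < K → K ≤ z → IsLn z y → 1# - K ⁻¹ ≤ y
  1-K⁻¹≤ln {K} {z} {y} 1<K@(1≤K , _) K≤z y↦z = ≮⇒≥ λ y<1-K⁻¹ →
    let K⁻¹<1-y : K ⁻¹ < 1# - y
        K⁻¹<1-y = ≰⇒> λ 1-y≤K⁻¹ → <⇒≱ y<1-K⁻¹ (≤-via-difference (0≤difference 1-y≤K⁻¹)
          (solve 2 (λ k y → k :- (con 1ℤ :- y) := y :- (con 1ℤ :- k)) ≈-refl (K ⁻¹) y))
        0<1-y : 0# < 1# - y
        0<1-y = ≤-<-trans (proj₁ (⁻¹-positive 0<K)) K⁻¹<1-y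
        y<1 : y < 1#
        y<1 = ≰⇒> λ 1≤y → <⇒≱ 0<1-y (≤-via-difference (0≤difference 1≤y)
          (solve 1 (λ y → y :- con 1ℤ := con 0ℤ :- (con 1ℤ :- y)) ≈-refl y))
        K≤[1-y]⁻¹ : K ≤ (1# - y) ⁻¹
        K≤[1-y]⁻¹ = ≤-trans K≤z (exp-≤-[1-y]⁻¹ y↦z y<1)
    in <⇒≱ K⁻¹<1-y (*-cancelˡ-≤ 0<K (≤-trans
         (≤-trans (≤-reflexive (*-comm K _)) (*-monoˡ-≤ (proj₁ 0<1-y) K≤[1-y]⁻¹))
         (≤-reflexive (≈-trans (⁻¹-inverseʳ (0<⇒≉0 0<1-y)) (≈-sym (⁻¹-inverseʳ (0<⇒≉0 0<K)))))))
    where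
    0<K : 0# < K
    0<K = ≤-<-trans 0≤1 1<K

  -- Along the indices m = n k the term (1 + y/m)^m is the k-th power of (1 + t/n)^n with
  -- t = y/k < 1/2, and the latter is at most 1/(1 - t) < 2.
  2^k≤exp⇒k≤2y : ∀ {y z} k → 0# ≤ y → IsExp y z → 2# ^ k ≤ z → fromℕ k ≤ 2# * y
  2^k≤exp⇒k≤2y {y} zero 0≤y _ _ = *-nonNegative 0≤2 0≤y
  2^k≤exp⇒k≤2y {y} {z} (suc k) 0≤y y↦z 2^k≤z = ≮⇒≥ λ 2y<K →
    let 2t<1 : 2# * t < 1#
        2t<1 = ≰⇒> λ 1≤2t → <⇒≱ 2y<K (≤-respʳ-≈ K*2t≈2y (≤-respˡ-≈ (*-identityʳ K) (*-monoˡ-≤ (proj₁ 0<K) 1≤2t)))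
        t<1 : t < 1#
        t<1 = ≤-<-trans (≤-via-difference 0≤t (solve 1 (λ t → t := (con 1ℤ :+ con 1ℤ) :* t :- t) ≈-refl t)) 2t<1
        0<1-t : 0# < 1# - t
        0<1-t = 0<difference t<1
        b : Carrier
        b = (1# - t) ⁻¹
        b<2 : b < 2#
        b<2 = ≰⇒> λ 2≤b → <⇒≱ 2t<1 (≤-via-difference
          (0≤difference (≤-respʳ-≈ (⁻¹-inverseʳ (0<⇒≉0 0<1-t)) (*-monoˡ-≤ (proj₁ 0<1-t) 2≤b)))
          (solve 1 (λ t → con 1ℤ :- (con 1ℤ :- t) :* (con 1ℤ :+ con 1ℤ) := (con 1ℤ :+ con 1ℤ) :* t :- con 1ℤ) ≈-refl t))
        z≤b^k : z ≤ b ^ suc k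
        z≤b^k = exp-≤ y↦z λ N above →
          <⇒≱ (above (k ℕ.+ N ℕ.* suc k) (ℕ.≤-trans (ℕ.m≤m*n N (suc k)) (ℕ.m≤n+m _ k)))
            (≤-respˡ-≈ (≈-sym (expTerm-split N))
              (^-mono-≤ (suc k) (^-nonNegative (suc N) (+-nonNegative 0≤1 (÷-nonNegative 0≤t (fromℕ-suc-positive N))))
                ([1+y÷k]^k≤[1-y]⁻¹ N (≤-trans (-‿anti-≤ (fromℕ-nonNegative (suc N)))
                   (≤-respˡ-≈ (solve 0 (con 0ℤ := :- con 0ℤ) ≈-refl) 0≤t)) t<1)))
    in <⇒≱ (^-monoˡ-< k (proj₁ (⁻¹-positive 0<1-t)) b<2) (≤-trans 2^k≤z z≤b^k)
    where
    K : Carrier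
    K = fromℕ (suc k)

    0<K : 0# < K
    0<K = fromℕ-suc-positive k

    t : Carrier
    t = y ÷ K

    0≤t : 0# ≤ t
    0≤t = ÷-nonNegative 0≤y 0<K

    K*2t≈2y : K * (2# * t) ≈ 2# * y
    K*2t≈2y = ≈-trans (solve 3 (λ k c t → k :* (c :* t) := c :* (k :* t)) ≈-refl K 2# t) (*-congˡ (÷-cancel y 0<K))

    -- `expTerm` at index i has exponent i + 1, and the successor of the index used here computes to
    -- `suc N * suc k`.
    expTerm-split : ∀ N → expTerm y (k ℕ.+ N ℕ.* suc k) ≈ expTerm t N ^ suc k
    expTerm-split N = begin
      (1# + y ÷ fromℕ (n ℕ.* suc k)) ^ (n ℕ.* suc k)  ≈⟨ ^-congˡ (n ℕ.* suc k) (+-congˡ y÷m≈t÷n) ⟩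
      (1# + t ÷ fromℕ n) ^ (n ℕ.* suc k)              ≈⟨ ^-assocʳ (1# + t ÷ fromℕ n) n (suc k) ⟨
      expTerm t N ^ suc k                             ∎
      where
      n : ℕ
      n = suc N

      y÷m≈t÷n : y ÷ fromℕ (n ℕ.* suc k) ≈ t ÷ fromℕ n
      y÷m≈t÷n = *-cancelˡ-≈ (fromℕ-suc-positive (k ℕ.+ N ℕ.* suc k)) (begin
        fromℕ (n ℕ.* suc k) * (y ÷ fromℕ (n ℕ.* suc k))  ≈⟨ ÷-cancel y (fromℕ-suc-positive (k ℕ.+ N ℕ.* suc k)) ⟩
        y                                                ≈⟨ ÷-cancel y 0<K ⟨
        K * t                                            ≈⟨ *-congˡ (÷-cancel t (fromℕ-suc-positive N)) ⟨
        K * (fromℕ n * (t ÷ fromℕ n))                    ≈⟨ solve 3 (λ k n x → k :* (n :* x) := n :* k :* x) ≈-refl K (fromℕ n) (t ÷ fromℕ n) ⟩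
        fromℕ n * K * (t ÷ fromℕ n)                      ≈⟨ *-congʳ (×1-homo-* n (suc k)) ⟨
        fromℕ (n ℕ.* suc k) * (t ÷ fromℕ n)              ∎)

  k≤2^k : ∀ k → fromℕ k ≤ 2# ^ k
  k≤2^k zero    = 0≤1
  k≤2^k (suc k) = ≤-respʳ-≈ (solve 1 (λ x → x :+ x := (con 1ℤ :+ con 1ℤ) :* x) ≈-refl (2# ^ k))
    (+-mono-≤ (1≤2^k k) (k≤2^k k))
    where
    1≤2^k : ∀ k → 1# ≤ 2# ^ k
    1≤2^k zero    = ≤-refl
    1≤2^k (suc k) = ≤-respˡ-≈ (*-identityˡ 1#)
      (*-mono-≤ 0≤1 (^-nonNegative k 0≤2) (x≤x+y 1# 0≤1) (1≤2^k k))

  -- The alternative `k ≡ 0` keeps the set inhabited for z < 1, so that `log₂` is total and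
  -- nonnegative; z = 0 occurs when no path is given.
  IsBinaryLength : Carrier → Carrier → Set
  IsBinaryLength z q = ∃ λ k → q ≈ fromℕ k × (k ≡ 0 ⊎ 2# ^ k ≤ z)

  -- A supremum in place of a least natural number: the axioms for Reals do not
  -- let one extract a natural number above a given real.
  log₂-sup : ∀ z → ∃ λ u → IsUpperBound (IsBinaryLength z) u × (∀ {b} → IsUpperBound (IsBinaryLength z) b → u ≤ b)
  log₂-sup z = complete (IsBinaryLength z) (0# , 0 , ≈-refl , inj₁ ≡.refl) (bounded (≤-total 0# z))
    where
    bounded : 0# ≤ z ⊎ z ≤ 0# → ∃ (IsUpperBound (IsBinaryLength z))
    bounded (inj₁ 0≤z) = z , λ where
      (_ , q≈0 , inj₁ ≡.refl) → ≤-respˡ-≈ (≈-sym q≈0) 0≤z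
      (k , q≈k , inj₂ 2^k≤z)  → ≤-respˡ-≈ (≈-sym q≈k) (≤-trans (k≤2^k k) 2^k≤z)
    bounded (inj₂ z≤0) = 0# , λ where
      (_ , q≈0 , inj₁ ≡.refl) → ≤-reflexive q≈0
      (k , q≈k , inj₂ 2^k≤z)  → ≤-respˡ-≈ (≈-sym q≈k) (≤-trans (k≤2^k k) (≤-trans 2^k≤z z≤0))

  log₂ : Carrier → Carrier
  log₂ z = proj₁ (log₂-sup z)

  k≤log₂ : ∀ z k → k ≡ 0 ⊎ 2# ^ k ≤ z → fromℕ k ≤ log₂ z
  k≤log₂ z k 2^k≤z = proj₁ (proj₂ (log₂-sup z)) (k , ≈-refl , 2^k≤z)

  log₂-least : ∀ z {b} → 0# ≤ b → (∀ k → 2# ^ k ≤ z → fromℕ k ≤ b) → log₂ z ≤ b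
  log₂-least z 0≤b k≤b = proj₂ (proj₂ (log₂-sup z)) λ where
    (_ , q≈0 , inj₁ ≡.refl) → ≤-respˡ-≈ (≈-sym q≈0) 0≤b
    (k , q≈k , inj₂ 2^k≤z)  → ≤-respˡ-≈ (≈-sym q≈k) (k≤b k 2^k≤z)

  0≤log₂ : ∀ z → 0# ≤ log₂ z
  0≤log₂ z = k≤log₂ z 0 (inj₁ ≡.refl)

  log₂-mono-≤ : ∀ {z w} → z ≤ w → log₂ z ≤ log₂ w
  log₂-mono-≤ {z} {w} z≤w = log₂-least z (0≤log₂ w) λ k 2^k≤z → k≤log₂ w k (inj₂ (≤-trans 2^k≤z z≤w))

  -- This stands in for rounding log₂ z down. If every k ≤ log₂ z had 2ᵏ⁺¹ < z, then k + 1 would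
  -- again be at most log₂ z, and induction would place all naturals below log₂ z.
  ¬¬log₂-ceiling : ∀ z → ¬ (∀ k → fromℕ k ≤ log₂ z → ¬ (z ≤ 2# ^ suc k))
  ¬¬log₂-ceiling z none = archimedean (log₂ z) below
    where
    below : ∀ k → fromℕ k ≤ log₂ z
    below zero    = 0≤log₂ z
    below (suc k) = k≤log₂ z (suc k) (inj₂ (proj₁ (≰⇒> (none k (below k)))))

  affine-log₂-IsFunction : ∀ a → IsFunction (λ z → a * (fromℕ 3 + log₂ z))
  affine-log₂-IsFunction a z≈w = *-congˡ (+-congˡ (≤-antisym
    (log₂-mono-≤ (≤-reflexive z≈w)) (log₂-mono-≤ (≤-reflexive (≈-sym z≈w)))))

  -- In the constant, 3/δ comes from 1 ≤ (ln z)/δ with δ = 1 - 1/K, and 2 from log₂ z ≤ 2 ln z.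
  affine-log₂-IsO-ln : ∀ {a} → 0# < a → IsO-ln (λ z → a * (fromℕ 3 + log₂ z))
  affine-log₂-IsO-ln {a} 0<a@(0≤a , _) {K} 1<K@(1≤K , _) = a * (fromℕ 3 * δ ⁻¹ + 2#) , 0<C , bounds
    where
    0<K : 0# < K
    0<K = ≤-<-trans 0≤1 1<K

    δ : Carrier
    δ = 1# - K ⁻¹

    0<δ : 0# < δ
    0<δ = 0<difference (≰⇒> λ 1≤K⁻¹ → <⇒≱ 1<K
      (≤-respˡ-≈ (*-identityʳ K) (≤-respʳ-≈ (⁻¹-inverseʳ (0<⇒≉0 0<K)) (*-monoˡ-≤ (proj₁ 0<K) 1≤K⁻¹))))

    0≤3 : 0# ≤ fromℕ 3
    0≤3 = fromℕ-nonNegative 3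

    0≤δ⁻¹ : 0# ≤ δ ⁻¹
    0≤δ⁻¹ = proj₁ (⁻¹-positive 0<δ)

    0<C : 0# < a * (fromℕ 3 * δ ⁻¹ + 2#)
    0<C = *-positive 0<a (<-≤-trans 0<2 (x≤y+x 2# (*-nonNegative 0≤3 0≤δ⁻¹)))

    bounds : ∀ {z y} → K ≤ z → IsLn z y →
             0# ≤ a * (fromℕ 3 + log₂ z) × a * (fromℕ 3 + log₂ z) ≤ a * (fromℕ 3 * δ ⁻¹ + 2#) * y
    bounds {z} {y} K≤z y↦z =
      *-nonNegative 0≤a (+-nonNegative 0≤3 (0≤log₂ z)) ,
      ≤-trans (*-monoˡ-≤ 0≤a (+-mono-≤ 3≤3δ⁻¹y log₂z≤2y))
        (≤-reflexive (solve 4 (λ a u c y → a :* (u :* y :+ c :* y) := a :* (u :+ c) :* y) ≈-refl a (fromℕ 3 * δ ⁻¹) 2# y))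
      where
      δ≤y : δ ≤ y
      δ≤y = 1-K⁻¹≤ln 1<K K≤z y↦z

      3≤3δ⁻¹y : fromℕ 3 ≤ fromℕ 3 * δ ⁻¹ * y
      3≤3δ⁻¹y = ≤-respˡ-≈ (*-identityʳ _) (≤-respʳ-≈ (≈-sym (*-assoc _ _ _))
        (*-monoˡ-≤ 0≤3 (≤-respˡ-≈ (⁻¹-inverseˡ 0<δ) (*-monoˡ-≤ 0≤δ⁻¹ δ≤y))))

      log₂z≤2y : log₂ z ≤ 2# * y
      log₂z≤2y = log₂-least z (*-nonNegative 0≤2 0≤y) λ k → 2^k≤exp⇒k≤2y k 0≤y y↦z
        where
        0≤y : 0# ≤ y
        0≤y = ≤-trans (proj₁ 0<δ) δ≤y

-- Finite sums, and subadditivity of increments under truncation.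

module FiniteSums (R : Reals) where
  open OrderedFieldProperties R
  open SumProperties semiring public using (sum-cong-≋; sum-replicate; sum-replicate-zero; ∑-distrib-+; *-distribˡ-sum)

  sum-mono-≤ : ∀ {n} {x y : Vector Carrier n} → (∀ i → x i ≤ y i) → sum x ≤ sum y
  sum-mono-≤ {zero}  x≤y = ≤-refl
  sum-mono-≤ {suc n} x≤y = +-mono-≤ (x≤y zero) (sum-mono-≤ (x≤y ∘ suc))

  sum-nonNegative : ∀ {n} {x : Vector Carrier n} → (∀ i → 0# ≤ x i) → 0# ≤ sum x
  sum-nonNegative {zero}  0≤x = ≤-refl
  sum-nonNegative {suc n} 0≤x = +-nonNegative (0≤x zero) (sum-nonNegative (0≤x ∘ suc))

  term≤sum : ∀ {n} {x : Vector Carrier n} → (∀ i → 0# ≤ x i) → ∀ i → x i ≤ sum x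
  term≤sum 0≤x zero    = x≤x+y _ (sum-nonNegative (0≤x ∘ suc))
  term≤sum 0≤x (suc i) = ≤-trans (term≤sum (0≤x ∘ suc) i) (x≤y+x _ (0≤x zero))

  module _ {A : Set} where

    ∑-mono-≤ : ∀ xs {g h : A → Carrier} → (∀ {a} → a ∈ xs → g a ≤ h a) → ∑ xs g ≤ ∑ xs h
    ∑-mono-≤ []       g≤h = ≤-refl
    ∑-mono-≤ (x ∷ xs) g≤h = +-mono-≤ (g≤h (here ≡.refl)) (∑-mono-≤ xs (g≤h ∘ there))

    ∑-nonNegative : ∀ xs {g : A → Carrier} → (∀ a → 0# ≤ g a) → 0# ≤ ∑ xs g
    ∑-nonNegative []       0≤g = ≤-refl
    ∑-nonNegative (x ∷ xs) 0≤g = +-nonNegative (0≤g x) (∑-nonNegative xs 0≤g)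

    term≤∑ : ∀ {xs} {g : A → Carrier} → (∀ a → 0# ≤ g a) → ∀ {a} → a ∈ xs → g a ≤ ∑ xs g
    term≤∑ {x ∷ xs} 0≤g (here ≡.refl) = x≤x+y _ (∑-nonNegative xs 0≤g)
    term≤∑ {x ∷ xs} 0≤g (there a∈xs)  = ≤-trans (term≤∑ 0≤g a∈xs) (x≤y+x _ (0≤g x))

    ∑-+ : ∀ xs (g h : A → Carrier) → ∑ xs (λ a → g a + h a) ≈ ∑ xs g + ∑ xs h
    ∑-+ []       g h = ≈-sym (+-identityˡ 0#)
    ∑-+ (x ∷ xs) g h = ≈-trans (+-congˡ (∑-+ xs g h))
      (solve 4 (λ a b c d → (a :+ b) :+ (c :+ d) := (a :+ c) :+ (b :+ d)) ≈-refl (g x) (h x) (∑ xs g) (∑ xs h))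

    ∑-- : ∀ xs (g h : A → Carrier) → ∑ xs (λ a → g a - h a) ≈ ∑ xs g - ∑ xs h
    ∑-- []       g h = ≈-sym (-‿inverseʳ 0#)
    ∑-- (x ∷ xs) g h = ≈-trans (+-congˡ (∑-- xs g h))
      (solve 4 (λ a b c d → (a :- b) :+ (c :- d) := (a :+ c) :- (b :+ d)) ≈-refl (g x) (h x) (∑ xs g) (∑ xs h))

    ∑-const : ∀ (xs : List A) b → ∑ xs (λ _ → b) ≈ fromℕ (length xs) * b
    ∑-const []       b = ≈-sym (zeroˡ b)
    ∑-const (x ∷ xs) b = ≈-trans (+-congˡ (∑-const xs b))
      (solve 2 (λ k b → b :+ k :* b := (con 1ℤ :+ k) :* b) ≈-refl (fromℕ (length xs)) b)

    ∑-sum-comm : ∀ {n} xs (g : Fin n → A → Carrier) → sum (λ v → ∑ xs (g v)) ≈ ∑ xs (λ a → sum (λ v → g v a))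
    ∑-sum-comm {n} []   g = sum-replicate-zero n
    ∑-sum-comm (x ∷ xs) g = ≈-trans (∑-distrib-+ (λ v → g v x) (λ v → ∑ xs (g v))) (+-congˡ (∑-sum-comm xs g))

    ∑-filter-≤ : ∀ {P : A → Set} (P? : Decidable P) xs {g : A → Carrier} →
                 (∀ a → 0# ≤ g a) → ∑ (filter P? xs) g ≤ ∑ xs g
    ∑-filter-≤ P? []       0≤g = ≤-refl
    ∑-filter-≤ P? (x ∷ xs) 0≤g with P? x
    ... | yes _ = +-monoʳ-≤ _ (∑-filter-≤ P? xs 0≤g)
    ... | no  _ = ≤-trans (∑-filter-≤ P? xs 0≤g) (x≤y+x _ (0≤g x))

  -- This is concavity of truncation. If one of a + s, a + t is cut to T, it dominates the joint
  -- term while the other dominates `a ⊓ T`. If neither is cut, the right side is the untruncated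
  -- sum, which equals that of the left.
  ⊓-submodular : ∀ {a s t} T → 0# ≤ s → 0# ≤ t →
                 (a + (s + t)) ⊓ T + a ⊓ T ≤ (a + s) ⊓ T + (a + t) ⊓ T
  ⊓-submodular {a} {s} {t} T 0≤s 0≤t with ⊓-sel (a + s) T | ⊓-sel (a + t) T
  ... | inj₂ ⊓≈T | _ = +-mono-≤ (≤-respʳ-≈ (≈-sym ⊓≈T) (x⊓y≤y _ T)) (⊓-mono-≤ (x≤x+y a 0≤t) ≤-refl)
  ... | inj₁ _   | inj₂ ⊓≈T = ≤-respˡ-≈ (+-comm _ _)
    (+-mono-≤ (⊓-mono-≤ (x≤x+y a 0≤s) ≤-refl) (≤-respʳ-≈ (≈-sym ⊓≈T) (x⊓y≤y _ T)))
  ... | inj₁ ⊓≈a+s | inj₁ ⊓≈a+t = ≤-trans (+-mono-≤ (x⊓y≤x _ T) (x⊓y≤x a T))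
    (≤-reflexive (≈-trans (solve 3 (λ a s t → (a :+ (s :+ t)) :+ a := (a :+ s) :+ (a :+ t)) ≈-refl a s t)
      (≈-sym (+-cong ⊓≈a+s ⊓≈a+t))))

  -- Splitting off `t zero` by `⊓-submodular` leaves the other increments over the same base `a`, so
  -- the induction hypothesis applies unchanged.
  ⊓-increment-subadditive : ∀ {n} a T (t : Vector Carrier n) → (∀ v → 0# ≤ t v) →
    (a + sum t) ⊓ T - a ⊓ T ≤ sum (λ v → (a + t v) ⊓ T - a ⊓ T)
  ⊓-increment-subadditive {zero}  a T t 0≤t = ≤-reflexive
    (≈-trans (+-congʳ (⊓-cong (+-identityʳ a) ≈-refl)) (-‿inverseʳ (a ⊓ T)))
  ⊓-increment-subadditive {suc n} a T t 0≤t = ≤-trans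
    (≤-via-difference (0≤difference (⊓-submodular {a} T (0≤t zero) (sum-nonNegative (0≤t ∘ suc))))
      (solve 4 (λ m i j k → i :+ j :- (k :+ m) := (i :- m :+ (j :- m)) :- (k :- m)) ≈-refl
        (a ⊓ T) ((a + t zero) ⊓ T) ((a + sum (t ∘ suc)) ⊓ T) ((a + sum t) ⊓ T)))
    (+-monoʳ-≤ _ (⊓-increment-subadditive a T (t ∘ suc) (0≤t ∘ suc)))

-- Single-entry vectors and norms.

module ImpactVectors (R : Reals) where
  open OrderedFieldProperties R
  open FiniteSums R
  open ThresholdBlocking R

  ⟨⟩-diagonal : ∀ {n} (v : Fin n) y → ⟨ v , y ⟩ v ≡ y
  ⟨⟩-diagonal v y = updateAt-updates v 𝟎

  ⟨⟩-nonNegative : ∀ {n} (v : Fin n) {y} → 0# ≤ y → NonNegative ⟨ v , y ⟩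
  ⟨⟩-nonNegative zero    0≤y zero    = 0≤y
  ⟨⟩-nonNegative zero    0≤y (suc u) = ≤-refl
  ⟨⟩-nonNegative (suc v) 0≤y zero    = ≤-refl
  ⟨⟩-nonNegative (suc v) 0≤y (suc u) = ⟨⟩-nonNegative v 0≤y u

  ⟨⟩-mono-≤ : ∀ {n} (v : Fin n) {y z} → y ≤ z → ∀ u → ⟨ v , y ⟩ u ≤ ⟨ v , z ⟩ u
  ⟨⟩-mono-≤ zero    y≤z zero    = y≤z
  ⟨⟩-mono-≤ zero    y≤z (suc u) = ≤-refl
  ⟨⟩-mono-≤ (suc v) y≤z zero    = ≤-refl
  ⟨⟩-mono-≤ (suc v) y≤z (suc u) = ⟨⟩-mono-≤ v y≤z u

  ⟨⟩-zero : ∀ {n} (v : Fin n) u → ⟨ v , 0# ⟩ u ≡ 0#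
  ⟨⟩-zero zero    zero    = ≡.refl
  ⟨⟩-zero zero    (suc u) = ≡.refl
  ⟨⟩-zero (suc v) zero    = ≡.refl
  ⟨⟩-zero (suc v) (suc u) = ⟨⟩-zero v u

  ‖𝟎‖≈0 : ∀ n → ‖ 𝟎 {n} ‖ ≈ 0#
  ‖𝟎‖≈0 = sum-replicate-zero

  ‖⟨⟩‖≈ : ∀ {n} (v : Fin n) y → ‖ ⟨ v , y ⟩ ‖ ≈ y
  ‖⟨⟩‖≈ {suc n} zero y = ≈-trans (+-congˡ (‖𝟎‖≈0 n)) (+-identityʳ y)
  ‖⟨⟩‖≈ (suc v)      y = ≈-trans (+-identityˡ _) (‖⟨⟩‖≈ v y)

  ‖s⊕⟨⟩‖≈ : ∀ {n} (s : Vector Carrier n) v y → ‖ s ⊕ ⟨ v , y ⟩ ‖ ≈ ‖ s ‖ + y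
  ‖s⊕⟨⟩‖≈ s v y = ≈-trans (∑-distrib-+ s ⟨ v , y ⟩) (+-congˡ (‖⟨⟩‖≈ v y))

  ⊕-nonNegative : ∀ {n} {x y : Vector Carrier n} → NonNegative x → NonNegative y → NonNegative (x ⊕ y)
  ⊕-nonNegative 0≤x 0≤y v = +-nonNegative (0≤x v) (0≤y v)

-- The potential and the gain of one greedy step.

module Gains (R : Reals) (I : ThresholdBlocking.Instance R) where
  open OrderedFieldProperties R
  open FiniteSums R
  open ImpactVectors R
  open ThresholdBlocking R
  open Instance I
  open SetoidReasoning setoid

  d-mono-≤ : ∀ {w w′} → NonNegative w → (∀ v → w v ≤ w′ v) → ∀ p → d w p ≤ d w′ p
  d-mono-≤ 0≤w w≤w′ p = ⊓-mono-≤ (∑-mono-≤ p λ {v} _ → f-mono v (0≤w v) (w≤w′ v)) ≤-refl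

  d-nonNegative : ∀ {w} → 0# ≤ T → NonNegative w → ∀ p → 0# ≤ d w p
  d-nonNegative 0≤T 0≤w p = ⊓-glb (∑-nonNegative p λ v → f-nonneg v (0≤w v)) 0≤T

  slack : Vector Carrier n → Path n → Carrier
  slack w p = T - d w p

  slack-nonNegative : ∀ w p → 0# ≤ slack w p
  slack-nonNegative w p = 0≤difference (x⊓y≤y _ T)

  potential : List (Path n) → Vector Carrier n → Carrier
  potential P w = ∑ P (slack w)

  w≤w⊕y : ∀ w {y : Vector Carrier n} → NonNegative y → ∀ v → w v ≤ (w ⊕ y) v
  w≤w⊕y w 0≤y v = x≤x+y (w v) (0≤y v)

  -- Before truncation the effect of `s` on a path is the sum of the effects `t v` of its single
  -- coordinates, so T ≤ a + Σ t. Truncating each effect separately can only enlarge the total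
  -- increment.
  slack≤∑gains : ∀ {w s} → NonNegative w → NonNegative s → ∀ p → T ≤ d (w ⊕ s) p →
                 slack w p ≤ sum (λ v → d (w ⊕ ⟨ v , s v ⟩) p - d w p)
  slack≤∑gains {w} {s} 0≤w 0≤s p T≤d =
    ≤-trans (+-mono-≤ (⊓-glb T≤a+∑t ≤-refl) ≤-refl)
      (≤-trans (⊓-increment-subadditive a T t λ v → ∑-nonNegative p (increment-nonNegative v))
        (≤-reflexive (sum-cong-≋ λ v → +-congʳ (⊓-cong (a+t≈ v) ≈-refl))))
    where
    raised : Fin n → Fin n → Carrier
    raised v u = f u ((w ⊕ ⟨ v , s v ⟩) u)

    increment : Fin n → Fin n → Carrier
    increment v u = raised v u - f u (w u)

    a : Carrier
    a = ∑ p (λ u → f u (w u))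

    t : Fin n → Carrier
    t v = ∑ p (increment v)

    increment-nonNegative : ∀ v u → 0# ≤ increment v u
    increment-nonNegative v u = 0≤difference (f-mono u (0≤w u) (w≤w⊕y w (⟨⟩-nonNegative v (0≤s v)) u))

    a+t≈ : ∀ v → a + t v ≈ ∑ p (raised v)
    a+t≈ v = ≈-trans (+-congˡ (∑-- p (raised v) (λ u → f u (w u))))
      (solve 2 (λ a b → a :+ (b :- a) := b) ≈-refl a (∑ p (raised v)))

    -- Only the diagonal term v = u is wanted. Since all increments are nonnegative, the sum over v
    -- bounds it without a proof that the other terms vanish.
    f[w+s]≤ : ∀ u → f u (w u + s u) ≤ f u (w u) + sum (λ v → increment v u)
    f[w+s]≤ u = ≤-trans
      (≤-reflexive (begin
        f u (w u + s u)                             ≡⟨ ≡.cong (λ y → f u (w u + y)) (⟨⟩-diagonal u (s u)) ⟨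
        raised u u                                  ≈⟨ solve 2 (λ a b → a :+ (b :- a) := b) ≈-refl (f u (w u)) (raised u u) ⟨
        f u (w u) + increment u u                   ∎))
      (+-monoʳ-≤ _ (term≤sum (λ v → increment-nonNegative v u) u))

    T≤a+∑t : T ≤ a + sum t
    T≤a+∑t = ≤-trans T≤d (≤-trans (x⊓y≤x _ T) (≤-trans (∑-mono-≤ p λ {u} _ → f[w+s]≤ u)
      (≤-reflexive (≈-trans (∑-+ p (λ u → f u (w u)) (λ u → sum (λ v → increment v u)))
        (+-congˡ (≈-sym (∑-sum-comm p increment)))))))

  module _ (P : List (Path n)) {w : Vector Carrier n} (0≤w : NonNegative w) (v : Fin n) where

    r-nonNegative : ∀ {y} → 0# ≤ y → 0# ≤ r P w v y
    r-nonNegative {y} 0≤y = ∑-nonNegative P λ p → 0≤difference (d-mono-≤ 0≤w (w≤w⊕y w (⟨⟩-nonNegative v 0≤y)) p)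

    r-mono-≤ : ∀ {y z} → 0# ≤ y → y ≤ z → r P w v y ≤ r P w v z
    r-mono-≤ 0≤y y≤z = ∑-mono-≤ P λ {p} _ → +-mono-≤
      (d-mono-≤ (⊕-nonNegative 0≤w (⟨⟩-nonNegative v 0≤y)) (λ u → +-monoʳ-≤ (w u) (⟨⟩-mono-≤ v y≤z u)) p) ≤-refl

    -- Vectors that agree up to `≈` are compared through `d-mono-≤` and `≤-reflexive`: monotonicity
    -- of `f` does the work of congruence.
    r[0]≤0 : r P w v 0# ≤ 0#
    r[0]≤0 = ≤-trans
      (∑-mono-≤ P λ {p} _ → ≤-trans
        (+-mono-≤ (d-mono-≤ (⊕-nonNegative 0≤w (⟨⟩-nonNegative v ≤-refl)) (λ u → ≤-reflexive (w⊕⟨v,0⟩≈w u)) p) ≤-refl)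
        (≤-reflexive (-‿inverseʳ (d w p))))
      (≤-reflexive (≈-trans (∑-const P 0#) (zeroʳ _)))
      where
      w⊕⟨v,0⟩≈w : ∀ u → (w ⊕ ⟨ v , 0# ⟩) u ≈ w u
      w⊕⟨v,0⟩≈w u = ≈-trans (+-congˡ (≈-reflexive (⟨⟩-zero v u))) (+-identityʳ (w u))

  -- A positive maximizer can only have the finite value `g x̂ ÷ x̂`, so the comparison of extended
  -- values reduces to one of reals.
  MaximizesRatio⇒≤ : ∀ {g D x̂ y} → MaximizesRatio g D x̂ → 0# < x̂ → D y → 0# < y → g y ≤ g x̂ ÷ x̂ * y
  MaximizesRatio⇒≤ (_ , _ , at-zero x̂≈0 _ , _) 0<x̂ _ _ = contradiction x̂≈0 (0<⇒≉0 0<x̂)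
  MaximizesRatio⇒≤ {g} {y = y} (_ , _ , at-positive _ , maximal) _ Dy 0<y =
    ≤-respˡ-≈ (÷-cancel (g y) 0<y) (≤-respʳ-≈ (*-comm y _)
      (*-monoˡ-≤ (proj₁ 0<y) ([≤]-injective _≤_ (maximal Dy (at-positive 0<y)))))

  Candidate⇒positive : ∀ {β g x̂} → 0# < β → Candidate β g x̂ → 0# < x̂
  Candidate⇒positive 0<β (regular (0≤x̂ , _) x̂≉0)   = 0≤x̂ , x̂≉0 ∘ ≈-sym
  Candidate⇒positive 0<β (jumpStart _ (β≤x̂ , _)) = <-≤-trans 0<β β≤x̂

  -- Below β a jump-started candidate says nothing about g, but there g y ≤ g β; hence the shift by β.
  Candidate⇒≤ : ∀ {β g x̂} → 0# < β → Candidate β g x̂ →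
                (∀ {y} → 0# ≤ y → 0# ≤ g y) → (∀ {y z} → 0# ≤ y → y ≤ z → g y ≤ g z) → g 0# ≤ 0# →
                ∀ {y} → 0# ≤ y → g y ≤ g x̂ ÷ x̂ * (y + β)
  Candidate⇒≤ {β} {g} {x̂} 0<β@(0≤β , _) candidate 0≤g g-mono g0≤0 {y} 0≤y = bound candidate
    where
    0<x̂ : 0# < x̂
    0<x̂ = Candidate⇒positive 0<β candidate

    0≤ρ : 0# ≤ g x̂ ÷ x̂
    0≤ρ = ÷-nonNegative (0≤g (proj₁ 0<x̂)) 0<x̂

    bound : Candidate β g x̂ → g y ≤ g x̂ ÷ x̂ * (y + β)
    bound (regular maximizes _) with y ≤? 0#
    ... | yes y≤0 = ≤-trans (≤-trans (g-mono 0≤y y≤0) g0≤0) (*-nonNegative 0≤ρ (+-nonNegative 0≤y 0≤β))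
    ... | no  y≰0 = ≤-trans (MaximizesRatio⇒≤ maximizes 0<x̂ 0≤y (≰⇒> y≰0)) (*-monoˡ-≤ 0≤ρ (x≤x+y y 0≤β))
    bound (jumpStart _ maximizes) with β ≤? y
    ... | yes β≤y = ≤-trans (MaximizesRatio⇒≤ maximizes 0<x̂ β≤y (<-≤-trans 0<β β≤y)) (*-monoˡ-≤ 0≤ρ (x≤x+y y 0≤β))
    ... | no  β≰y = ≤-trans (g-mono 0≤y (proj₁ (≰⇒> β≰y)))
      (≤-trans (MaximizesRatio⇒≤ maximizes 0<x̂ ≤-refl 0<β) (*-monoˡ-≤ 0≤ρ (x≤y+x β 0≤y)))

  module _ {s* : Vector Carrier n} (0≤s* : NonNegative s*) {β : Carrier} (0<β : 0# < β) where

    -- Each node's gain bound carries the shift β, so summing over the nodes adds n β to ‖s*‖. The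
    -- result is φ ≤ ρ B with the denominator of ρ cleared.
    greedy-progress : ∀ {P w} → NonNegative w → (∀ {p} → p ∈ P → T ≤ d (w ⊕ s*) p) →
      (x̂ : Vector Carrier n) → (∀ u → Candidate β (r P w u) (x̂ u)) →
      ∀ v → (∀ u → r P w u (x̂ u) ÷ x̂ u ≤ r P w v (x̂ v) ÷ x̂ v) →
      x̂ v * potential P w ≤ (‖ s* ‖ + fromℕ n * β) * r P w v (x̂ v)
    greedy-progress {P} {w} 0≤w T≤d x̂ candidate v greedy =
      ≤-trans (*-monoˡ-≤ (proj₁ 0<x̂v) potential≤) (≤-reflexive (begin
        x̂ v * (ρ * B)      ≈⟨ *-assoc _ _ _ ⟨
        x̂ v * ρ * B        ≈⟨ *-congʳ (÷-cancel _ 0<x̂v) ⟩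
        r P w v (x̂ v) * B  ≈⟨ *-comm _ _ ⟩
        B * r P w v (x̂ v)  ∎))
      where
      ρ B : Carrier
      ρ = r P w v (x̂ v) ÷ x̂ v
      B = ‖ s* ‖ + fromℕ n * β

      0<x̂v : 0# < x̂ v
      0<x̂v = Candidate⇒positive 0<β (candidate v)

      gain≤ : ∀ u → r P w u (s* u) ≤ ρ * (s* u + β)
      gain≤ u = ≤-trans
        (Candidate⇒≤ 0<β (candidate u) (r-nonNegative P 0≤w u) (r-mono-≤ P 0≤w u) (r[0]≤0 P 0≤w u) (0≤s* u))
        (≤-trans (≤-reflexive (*-comm _ _))
          (≤-trans (*-monoˡ-≤ (+-nonNegative (0≤s* u) (proj₁ 0<β)) (greedy u)) (≤-reflexive (*-comm _ _))))

      potential≤ : potential P w ≤ ρ * B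
      potential≤ = ≤-trans (∑-mono-≤ P λ {p} p∈P → slack≤∑gains 0≤w 0≤s* p (T≤d p∈P))
        (≤-trans (≤-reflexive (≈-sym (∑-sum-comm P λ u p → d (w ⊕ ⟨ u , s* u ⟩) p - d w p)))
          (≤-trans (sum-mono-≤ gain≤) (≤-reflexive (begin
            sum (λ u → ρ * (s* u + β))        ≈⟨ *-distribˡ-sum ρ (λ u → s* u + β) ⟨
            ρ * sum (λ u → s* u + β)          ≈⟨ *-congˡ (∑-distrib-+ s* (λ _ → β)) ⟩
            ρ * (‖ s* ‖ + sum {n} (λ _ → β))  ≈⟨ *-congˡ (+-congˡ (≈-trans (sum-replicate n) (n·β≈ n))) ⟩
            ρ * B                             ∎))))
        where
        n·β≈ : ∀ k → k · β ≈ fromℕ k * β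
        n·β≈ zero    = ≈-sym (zeroˡ β)
        n·β≈ (suc k) = ≈-trans (+-congˡ (n·β≈ k))
          (solve 2 (λ k b → b :+ k :* b := (con 1ℤ :+ k) :* b) ≈-refl (fromℕ k) β)

  -- Removing paths only lowers the sum, as slacks are nonnegative. The bracketings `w′` and `w″`
  -- agree only up to `≈`, so monotonicity compares them, in the one direction required.
  potential-decrease : ∀ P {s} v {y} → NonNegative s → 0# ≤ y →
    let w′ = x ⊕ (s ⊕ ⟨ v , y ⟩) in
    potential (removeBlocked w′ P) w′ ≤ potential P (x ⊕ s) - r P (x ⊕ s) v y
  potential-decrease P {s} v {y} 0≤s 0≤y = ≤-trans
    (∑-filter-≤ (λ p → ¬? (T * (1# - ε) ≤? d w′ p)) P (slack-nonNegative w′))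
    (≤-trans (∑-mono-≤ P λ {p} _ → slack≤ p) (≤-reflexive (∑-- P (slack w) (λ p → d w″ p - d w p))))
    where
    w w′ w″ : Vector Carrier n
    w  = x ⊕ s
    w′ = x ⊕ (s ⊕ ⟨ v , y ⟩)
    w″ = (x ⊕ s) ⊕ ⟨ v , y ⟩

    slack≤ : ∀ p → slack w′ p ≤ slack w p - (d w″ p - d w p)
    slack≤ p = ≤-via-difference
      (0≤difference (d-mono-≤ (⊕-nonNegative (⊕-nonNegative x-nonneg 0≤s) (⟨⟩-nonNegative v 0≤y))
        (λ u → ≤-reflexive (+-assoc (x u) (s u) _)) p))
      (solve 4 (λ t a b c → b :- c := (t :- a :- (c :- a)) :- (t :- b)) ≈-refl T (d w p) (d w′ p) (d w″ p))

  -- A path that survives the removal has d below T(1 - ε). This is the floor under the potential at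
  -- which the descent stops.
  removed-slack : ∀ {w P p} → p ∈ removeBlocked w P → p ∈ P × ε * T ≤ slack w p
  removed-slack {w} {P} {p} p∈ with ∈-filter⁻ (λ q → ¬? (T * (1# - ε) ≤? d w q)) {xs = P} p∈
  ... | p∈P , unblocked = p∈P , ≤-via-difference (0≤difference (proj₁ (≰⇒> unblocked)))
    (solve 3 (λ t e d → t :* (con 1ℤ :- e) :- d := (t :- d) :- e :* t) ≈-refl T ε (d w p))

-- Accounting over a whole run.

module GreedyRuns (R : Reals) (I : ThresholdBlocking.Instance R) where
  open OrderedFieldProperties R
  open LogarithmBounds R
  open FiniteSums R
  open ImpactVectors R
  open ThresholdBlocking R
  open Instance I
  open Gains R I
  open SetoidReasoning setoid

  module _ {s* : Vector Carrier n} (s*-blocks : Blocks s*) {β : Carrier} (0<β : 0# < β) where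

    M : Carrier
    M = ‖ s* ‖ + fromℕ n * β

    0≤M : 0# ≤ M
    0≤M = +-nonNegative (sum-nonNegative (proj₁ s*-blocks)) (*-nonNegative (fromℕ-nonNegative n) (proj₁ 0<β))

    infix 4 _⊆𝒫
    _⊆𝒫 : List (Path n) → Set
    P ⊆𝒫 = ∀ {p} → p ∈ P → p ∈ 𝒫

    T-positive : ∀ {p} → p ∈ 𝒫 → 0# < T
    T-positive {p} p∈𝒫 = ≤-<-trans (∑-nonNegative p λ v → f-nonneg v ≤-refl) (IsFeasible.belowThreshold (𝒫-feasible p∈𝒫))

    -- Adding `s` only lengthens paths, so `s*` stays a valid blocker at every stage and yields the
    -- same M throughout.
    T≤d[x⊕s⊕s*] : ∀ {P s} → P ⊆𝒫 → NonNegative s → ∀ {p} → p ∈ P → T ≤ d ((x ⊕ s) ⊕ s*) p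
    T≤d[x⊕s⊕s*] {s = s} P⊆𝒫 0≤s {p} p∈P = ≤-trans (proj₂ s*-blocks (P⊆𝒫 p∈P))
      (d-mono-≤ (⊕-nonNegative x-nonneg (proj₁ s*-blocks)) (λ v → +-mono-≤ (w≤w⊕y x 0≤s v) ≤-refl) p)

    scale : ℕ → Carrier
    scale k = 2# ^ k * (ε * T)

    -- The sign of `T` is derived from a path, so it cannot be used once none remains; 0 ≤ φ ≤ 2
    -- `scale k` gives the claim instead.
    scale-nonNegative : ∀ k {P w} → potential P w ≤ scale (suc k) → 0# ≤ scale k
    scale-nonNegative k {P} {w} φ≤scale = *-cancelˡ-≤ 0<2 (≤-respˡ-≈ (≈-sym (zeroʳ 2#))
      (≤-respʳ-≈ (*-assoc 2# (2# ^ k) (ε * T)) (≤-trans (∑-nonNegative P (slack-nonNegative w)) φ≤scale)))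

    module Step {P : List (Path n)} {s : Vector Carrier n} (P⊆𝒫 : P ⊆𝒫) (0≤s : NonNegative s)
                (x̂ : Vector Carrier n) (candidate : ∀ u → Candidate β (r P (x ⊕ s) u) (x̂ u)) (v : Fin n)
                (greedy : ∀ u → r P (x ⊕ s) u (x̂ u) ÷ x̂ u ≤ r P (x ⊕ s) v (x̂ v) ÷ x̂ v) where

      s⁺ w w⁺ : Vector Carrier n
      s⁺ = s ⊕ ⟨ v , x̂ v ⟩
      w  = x ⊕ s
      w⁺ = x ⊕ s⁺

      P⁺ : List (Path n)
      P⁺ = removeBlocked w⁺ P

      φ φ⁺ gain : Carrier
      φ    = potential P w
      φ⁺   = potential P⁺ w⁺
      gain = r P w v (x̂ v)

      0≤w : NonNegative w
      0≤w = ⊕-nonNegative x-nonneg 0≤s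

      0≤x̂v : 0# ≤ x̂ v
      0≤x̂v = proj₁ (Candidate⇒positive 0<β (candidate v))

      0≤s⁺ : NonNegative s⁺
      0≤s⁺ = ⊕-nonNegative 0≤s (⟨⟩-nonNegative v 0≤x̂v)

      P⁺⊆P : ∀ {p} → p ∈ P⁺ → p ∈ P
      P⁺⊆P p∈P⁺ = proj₁ (removed-slack {P = P} p∈P⁺)

      P⁺-slack : ∀ {p} → p ∈ P⁺ → ε * T ≤ slack w⁺ p
      P⁺-slack p∈P⁺ = proj₂ (removed-slack {P = P} p∈P⁺)

      progress : x̂ v * φ ≤ M * gain
      progress = greedy-progress (proj₁ s*-blocks) 0<β 0≤w (T≤d[x⊕s⊕s*] P⊆𝒫 0≤s) x̂ candidate v greedy

      decrease : φ⁺ ≤ φ - gain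
      decrease = potential-decrease P v 0≤s 0≤x̂v

      φ⁺≤φ : φ⁺ ≤ φ
      φ⁺≤φ = ≤-trans decrease (≤-via-difference (r-nonNegative P 0≤w v 0≤x̂v)
        (solve 2 (λ φ g → g := φ :- (φ :- g)) ≈-refl φ gain))

      gain≤φ : gain ≤ φ
      gain≤φ = ≤-via-difference (+-nonNegative (∑-nonNegative P⁺ (slack-nonNegative w⁺)) (0≤difference decrease))
        (solve 3 (λ φ φ⁺ g → φ⁺ :+ (φ :- g :- φ⁺) := φ :- g) ≈-refl φ φ⁺ gain)

    -- While the potential is above scale k, each unit added to s costs at least
    -- scale k / M of potential; below it the bound for k - 1 takes over.
    norm-increase : ∀ k {P s s′} → Run β P s s′ → P ⊆𝒫 → NonNegative s →
      (∀ {p} → p ∈ P → ε * T ≤ slack (x ⊕ s) p) →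
      potential P (x ⊕ s) ≤ scale (suc k) →
      scale k * (‖ s′ ‖ - ‖ s ‖) ≤ M * (fromℕ k * scale k + potential P (x ⊕ s))
    norm-increase k {s = s} done _ _ _ 0≤scale = ≤-trans
      (≤-reflexive (solve 2 (λ e s → e :* (s :- s) := con 0ℤ) ≈-refl (scale k) ‖ s ‖))
      (*-nonNegative 0≤M (+-nonNegative
        (*-nonNegative (fromℕ-nonNegative k) (scale-nonNegative k {P = []} {w = x} 0≤scale)) ≤-refl))
    norm-increase k {P} {s} (step _ _ _ _ _ _) P⊆𝒫 0≤s far φ≤scale with scale k ≤? potential P (x ⊕ s)
    norm-increase k {P} {s} {s′} (step _ x̂ candidate v greedy run) P⊆𝒫 0≤s far φ≤scale | yes scale≤φ =
      ≤-via-difference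
        (+-nonNegative (+-nonNegative (0≤difference rest) (0≤difference first)) (*-nonNegative 0≤M (0≤difference decrease)))
        (solve 9 (λ m c e φ φ⁺ g N S X →
            m :* (c :* e :+ φ⁺) :- e :* (N :- (S :+ X)) :+ (m :* g :- e :* X) :+ m :* (φ :- g :- φ⁺)
            := m :* (c :* e :+ φ) :- e :* (N :- S))
          ≈-refl M (fromℕ k) (scale k) φ φ⁺ gain ‖ s′ ‖ ‖ s ‖ (x̂ v))
      where
      open Step P⊆𝒫 0≤s x̂ candidate v greedy

      first : scale k * x̂ v ≤ M * gain
      first = ≤-trans (≤-trans (≤-reflexive (*-comm _ _)) (*-monoˡ-≤ 0≤x̂v scale≤φ)) progress

      rest : scale k * (‖ s′ ‖ - (‖ s ‖ + x̂ v)) ≤ M * (fromℕ k * scale k + φ⁺)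
      rest = ≤-respˡ-≈ (*-congˡ (+-congˡ (-‿cong (‖s⊕⟨⟩‖≈ s v (x̂ v)))))
        (norm-increase k run (P⊆𝒫 ∘ P⁺⊆P) 0≤s⁺ P⁺-slack (≤-trans φ⁺≤φ φ≤scale))
    -- At level 0 this case is impossible: a single remaining path already contributes ε T, which is
    -- `scale 0`.
    norm-increase zero {P} {s} (step P≢[] _ _ _ _ _) P⊆𝒫 0≤s far φ≤scale | no scale≰φ =
      contradiction (≤-respˡ-≈ (≈-sym (*-identityˡ _)) εT≤φ) scale≰φ
      where
      ∃∈ : ∀ {Q : List (Path n)} → Q ≢ [] → ∃ (_∈ Q)
      ∃∈ {[]}    Q≢[] = contradiction ≡.refl Q≢[]
      ∃∈ {p ∷ _} _    = p , here ≡.refl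

      εT≤φ : ε * T ≤ potential P (x ⊕ s)
      εT≤φ = let p , p∈P = ∃∈ P≢[] in ≤-trans (far p∈P) (term≤∑ (slack-nonNegative (x ⊕ s)) p∈P)
    -- With q = `scale k`, twice the bound for `k` is 2M(k q + φ), and φ ≤ 2q replaces one φ by 2q,
    -- giving M((k + 1) 2q + φ).
    norm-increase (suc k) {P} {s} {s′} run@(step _ _ _ _ _ _) P⊆𝒫 0≤s far φ≤scale | no scale≰φ =
      ≤-via-difference
        (+-nonNegative (*-nonNegative 0≤2 (0≤difference (norm-increase k run P⊆𝒫 0≤s far φ≤scale′)))
                       (*-nonNegative 0≤M (0≤difference φ≤scale′)))
        (solve 6 (λ m c q e φ N →
            (con 1ℤ :+ con 1ℤ) :* (m :* (c :* (q :* e) :+ φ) :- q :* e :* N) :+ m :* ((con 1ℤ :+ con 1ℤ) :* q :* e :- φ)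
            := m :* ((con 1ℤ :+ c) :* ((con 1ℤ :+ con 1ℤ) :* q :* e) :+ φ) :- (con 1ℤ :+ con 1ℤ) :* q :* e :* N)
          ≈-refl M (fromℕ k) (2# ^ k) (ε * T) (potential P (x ⊕ s)) (‖ s′ ‖ - ‖ s ‖))
      where
      φ≤scale′ : potential P (x ⊕ s) ≤ scale (suc k)
      φ≤scale′ = proj₁ (≰⇒> scale≰φ)

    -- The first step is treated apart: paths in P may start with slack below εT.
    total-norm-increase : ∀ k {P s s′} → Run β P s s′ → P ⊆𝒫 → NonNegative s →
      (∀ {p} → p ∈ P → 0# < slack (x ⊕ s) p) →
      fromℕ (length P) ≤ 2# ^ suc k * ε →
      ‖ s′ ‖ - ‖ s ‖ ≤ M * (fromℕ 3 + fromℕ k)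
    total-norm-increase k {s = s} done _ _ _ _ = ≤-respˡ-≈ (≈-sym (-‿inverseʳ ‖ s ‖))
      (*-nonNegative 0≤M (+-nonNegative (fromℕ-nonNegative 3) (fromℕ-nonNegative k)))
    total-norm-increase k {[]} (step P≢[] _ _ _ _ _) _ _ _ _ = contradiction ≡.refl P≢[]
    total-norm-increase k {P@(p ∷ _)} {s} {s′} (step _ x̂ candidate v greedy run) P⊆𝒫 0≤s 0<slack |P|≤ =
      ≤-via-difference (+-nonNegative (0≤difference rest) (0≤difference first))
        (solve 5 (λ m k N S X →
            m :* (k :+ (con 1ℤ :+ con 1ℤ)) :- (N :- (S :+ X)) :+ (m :- X)
            := m :* ((con 1ℤ :+ (con 1ℤ :+ (con 1ℤ :+ con 0ℤ))) :+ k) :- (N :- S))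
          ≈-refl M (fromℕ k) ‖ s′ ‖ ‖ s ‖ (x̂ v))
      where
      open Step P⊆𝒫 0≤s x̂ candidate v greedy

      0<T : 0# < T
      0<T = T-positive (P⊆𝒫 (here ≡.refl))

      0<scale : 0# < scale k
      0<scale = *-positive (^-positive k 0<2) (*-positive 0<ε 0<T)

      0<φ : 0# < φ
      0<φ = <-≤-trans (0<slack (here ≡.refl)) (term≤∑ {xs = P} (slack-nonNegative w) (here ≡.refl))

      -- No step can gain more than the whole potential, so x̂ v φ ≤ M φ; positivity of φ is what
      -- the slack hypothesis provides.
      first : x̂ v ≤ M
      first = *-cancelˡ-≤ 0<φ (≤-trans (≤-reflexive (*-comm φ (x̂ v)))
        (≤-trans progress (≤-trans (*-monoˡ-≤ 0≤M gain≤φ) (≤-reflexive (*-comm M φ)))))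

      slack≤T : ∀ p → slack w⁺ p ≤ T
      slack≤T p = ≤-via-difference (d-nonNegative (proj₁ 0<T) (⊕-nonNegative x-nonneg 0≤s⁺) p)
        (solve 2 (λ t d → d := t :- (t :- d)) ≈-refl T (d w⁺ p))

      φ⁺≤scale : φ⁺ ≤ scale (suc k)
      φ⁺≤scale = ≤-trans (∑-mono-≤ P⁺ λ {p} _ → slack≤T p) (≤-trans (≤-reflexive (∑-const P⁺ T))
        (≤-trans (*-mono-≤ (fromℕ-nonNegative (length P⁺)) (proj₁ 0<T)
            (≤-trans (fromℕ-mono-≤ (length-filter (λ q → ¬? (T * (1# - ε) ≤? d w⁺ q)) P)) |P|≤) ≤-refl)
          (≤-reflexive (*-assoc (2# ^ suc k) ε T))))

      -- The summand `2#` is the starting potential, at most `scale (suc k)`, divided by `scale k`.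
      rest : ‖ s′ ‖ - (‖ s ‖ + x̂ v) ≤ M * (fromℕ k + 2#)
      rest = *-cancelˡ-≤ 0<scale (≤-trans
        (≤-respˡ-≈ (*-congˡ (+-congˡ (-‿cong (‖s⊕⟨⟩‖≈ s v (x̂ v)))))
          (norm-increase k run (P⊆𝒫 ∘ P⁺⊆P) 0≤s⁺ P⁺-slack φ⁺≤scale))
        (≤-trans (*-monoˡ-≤ 0≤M (+-monoʳ-≤ (fromℕ k * scale k) φ⁺≤scale))
          (≤-reflexive (solve 4 (λ m c q e →
              m :* (c :* (q :* e) :+ (con 1ℤ :+ con 1ℤ) :* q :* e) := q :* e :* (m :* (c :+ (con 1ℤ :+ con 1ℤ))))
            ≈-refl M (fromℕ k) (2# ^ k) (ε * T)))))

    returned-norm : ∀ k {s} → JumpStartGreedyReturns β s → |𝒫|ε⁻¹ ≤ 2# ^ suc k → ‖ s ‖ ≤ M * (fromℕ 3 + fromℕ k)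
    returned-norm k {s} run |𝒫|ε⁻¹≤ = ≤-respˡ-≈ ‖s‖-‖𝟎‖≈
      (total-norm-increase k run (λ p∈𝒫 → p∈𝒫) (λ _ → ≤-refl) 0<slack
        (≤-respˡ-≈ |𝒫|≈ (≤-respʳ-≈ (*-comm ε _) (*-monoˡ-≤ (proj₁ 0<ε) |𝒫|ε⁻¹≤))))
      where
      ‖s‖-‖𝟎‖≈ : ‖ s ‖ - ‖ 𝟎 {n} ‖ ≈ ‖ s ‖
      ‖s‖-‖𝟎‖≈ = ≈-trans (+-congˡ (-‿cong (‖𝟎‖≈0 n))) (solve 1 (λ s → s :- con 0ℤ := s) ≈-refl ‖ s ‖)

      0<slack : ∀ {p} → p ∈ 𝒫 → 0# < slack (x ⊕ 𝟎) p
      0<slack {p} p∈𝒫 = 0<difference (≤-<-trans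
        (d-mono-≤ (⊕-nonNegative x-nonneg (λ _ → ≤-refl)) (λ v → ≤-reflexive (+-identityʳ (x v))) p) (𝒫-below p∈𝒫))

      |𝒫|≈ : ε * |𝒫|ε⁻¹ ≈ fromℕ (length 𝒫)
      |𝒫|≈ = ÷-cancel (fromℕ (length 𝒫)) 0<ε

  -- The case k = 0 is separate because `0# ⁻¹` is unspecified, so the bound on β then says nothing;
  -- but k β = 0.
  k*β≤c*S : ∀ k {c β S} → 0# ≤ c → 0# ≤ S → β ≤ c * (S ÷ fromℕ k) → fromℕ k * β ≤ c * S
  k*β≤c*S zero    {β = β} 0≤c 0≤S _ = ≤-respˡ-≈ (≈-sym (zeroˡ β)) (*-nonNegative 0≤c 0≤S)
  k*β≤c*S (suc k) {c} {S = S} _ _ β≤ = ≤-trans (*-monoˡ-≤ (fromℕ-nonNegative (suc k)) β≤) (≤-reflexive (begin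
    fromℕ (suc k) * (c * (S ÷ fromℕ (suc k)))  ≈⟨ solve 3 (λ k c x → k :* (c :* x) := c :* (k :* x)) ≈-refl (fromℕ (suc k)) c (S ÷ fromℕ (suc k)) ⟩
    c * (fromℕ (suc k) * (S ÷ fromℕ (suc k)))  ≈⟨ *-congˡ (÷-cancel S (fromℕ-suc-positive k)) ⟩
    c * S                                      ∎))

  jumpStartGreedy-approximation : ∀ {c s s* β} → 0# < c → IsOptimal s* → 0# < β → β ≤ c * (‖ s* ‖ ÷ fromℕ n) →
    JumpStartGreedyReturns β s → ‖ s ‖ ≤ (1# + c) * (fromℕ 3 + log₂ |𝒫|ε⁻¹) * ‖ s* ‖
  jumpStartGreedy-approximation {c} {s} {s*} {β} (0≤c , _) (s*-blocks , _) 0<β β≤ run =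
    -- The exponent `k` is available only while refuting the negated goal; there k ≤ log₂ z removes
    -- it from the bound.
    ≤-stable λ ‖s‖≰ → ¬¬log₂-ceiling |𝒫|ε⁻¹ λ k k≤log₂ |𝒫|ε⁻¹≤ → ‖s‖≰
      (≤-trans (returned-norm s*-blocks 0<β k run |𝒫|ε⁻¹≤)
        (≤-trans (*-mono-≤ (0≤M s*-blocks 0<β) 0≤3+log₂ M≤ (+-monoʳ-≤ (fromℕ 3) k≤log₂))
          (≤-reflexive (solve 3 (λ a l s → a :* s :* l := a :* l :* s) ≈-refl (1# + c) (fromℕ 3 + log₂ |𝒫|ε⁻¹) ‖ s* ‖))))
    where
    0≤3+log₂ : 0# ≤ fromℕ 3 + log₂ |𝒫|ε⁻¹
    0≤3+log₂ = +-nonNegative (fromℕ-nonNegative 3) (0≤log₂ |𝒫|ε⁻¹)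

    M≤ : M s*-blocks 0<β ≤ (1# + c) * ‖ s* ‖
    M≤ = ≤-trans (+-monoʳ-≤ ‖ s* ‖ (k*β≤c*S n 0≤c (sum-nonNegative (proj₁ s*-blocks)) β≤))
      (≤-reflexive (solve 2 (λ c s → s :+ c :* s := (con 1ℤ :+ c) :* s) ≈-refl c ‖ s* ‖))

theorem3 : (R : Reals) →
    let open Reals R
        open ThresholdBlocking R
    in
    ∀ (c : Carrier) → 0# < c →
    ∃ λ (g : Carrier → Carrier) → IsFunction g × IsO-ln g ×
      (∀ (I : Instance) → let open Instance I in
       ∀ (s s* : Vector Carrier n) (β : Carrier) →
       IsOptimal s* →
       0# < β → β ≤ c * (‖ s* ‖ ÷ fromℕ n) →
       JumpStartGreedyReturns β s →
       ‖ s ‖ ≤ g |𝒫|ε⁻¹ * ‖ s* ‖)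
theorem3 R c 0<c =
  (λ z → (1# + c) * (fromℕ 3 + log₂ z)) ,
  affine-log₂-IsFunction (1# + c) ,
  affine-log₂-IsO-ln (<-≤-trans 0<1 (x≤x+y 1# (proj₁ 0<c))) ,
  λ I _ _ _ optimal 0<β β≤ run → GreedyRuns.jumpStartGreedy-approximation R I 0<c optimal 0<β β≤ run
  where
  open OrderedFieldProperties R
  open FiniteSums R
  open LogarithmBounds R
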